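{- Let $G=(V,E)$ be a connected graph and $G'=(V,E')$ a graph with $E\subseteq E'$. Then: (a) For any cycle $C$ in $G$ and any $e\in C$, the polytope $\Sigma_{GG'}(e,C)$ is a facet of $\Xi_{GG'}$ if and only if $C$ is chordless in $G'$. (b) For any edge $vw=f\in F_{GG'}$ and any $vw$-path $P$ in $G$, the polytope $\Sigma_{GG'}(f,P)$ is a facet of $\Xi_{GG'}$ if and only if the cycle $P\cup\{f\}$ is chordless in $G'$.
   Context: All graphs are finite, simple and undirected; an edge $\{v,w\}$ is also written $vw$. Paths and cycles have no repeated nodes and are identified with their edge sets. For distinct $v,w\in V$, $vw\text{ -paths}(G)$ is the set of all paths in $G$ from $v$ to $w$; a $vw$-cut of $G$ is an inclusion-minimal set $C\subseteq E$ such that $v$ and $w$ are not connected in $(V,E\setminus C)$, and $vw\text{ -cuts}(G)$ is the set of all of these. A cycle is chordless in $G'$ if no edge of $G'$ outside the cycle joins two nodes of the cycle. For a connected graph $G=(V,E)$ and a graph $G'=(V,E')$ with $E\subseteq E'$, let $F_{GG'}:=E'\setminus E$ and let $X_{GG'}$ be the set of all $x\in\{0,1\}^{E'}$ such that (i) $x_e\le\sum_{e'\in C\setminus\{e\}}x_{e'}$ for every cycle $C$ of $G$ and every $e\in C$; (ii) $x_{vw}\le\sum_{e\in P}x_e$ for every $vw\in F_{GG'}$ and every $P\in vw\text{ -paths}(G)$; (iii) $1-x_{vw}\le\sum_{e\in C}(1-x_e)$ for every $vw\in F_{GG'}$ and every $C\in vw\text{ -cuts}(G)$. The lifted multicut polytope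 is $\Xi_{GG'}:=\operatorname{conv}X_{GG'}\subset\mathbb{R}^{E'}$. For a cycle $C$ of $G$ and $e\in C$: $S_{GG'}(e,C):=\{x\in X_{GG'}\mid x_e=\sum_{e'\in C\setminus\{e\}}x_{e'}\}$ and $\Sigma_{GG'}(e,C):=\operatorname{conv}S_{GG'}(e,C)$. For $vw=f\in F_{GG'}$ and a $vw$-path $P$ in $G$: $S_{GG'}(f,P):=\{x\in X_{GG'}\mid x_{vw}=\sum_{e\in P}x_e\}$ and $\Sigma_{GG'}(f,P):=\operatorname{conv}S_{GG'}(f,P)$. -}

module Defs where

open import Algebra.Bundles using (CommutativeRing)
open import Algebra.Core using (Op₁; Op₂)
import Algebra.Properties.CommutativeMonoid.Sum as CommutativeMonoidSum
open import Algebra.Structures using (IsCommutativeRing)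
open import Data.Bool.Base using (if_then_else_)
open import Data.Fin.Base using (Fin)
open import Data.Fin.Subset using (Subset; _∈_; _∉_; _⊆_; _─_)
  renaming (_-_ to _∖_)
open import Data.List.Base as List using (List; []; _∷_; length)
import Data.List.Membership.Propositional as ListMembership
open import Data.List.Relation.Unary.Unique.Propositional using (Unique)
open import Data.Nat.Base as ℕ using (ℕ; suc)
open import Data.Product.Base using (Σ; ∃; ∃-syntax; _×_; _,_)
open import Data.Sum.Base using (_⊎_)
open import Data.Vec.Base using (lookup)
open import Data.Vec.Functional using (Vector)
open import Function.Bundles using (_⇔_)
open import Level using (Level; _⊔_) renaming (suc to lsuc)
open import Relation.Binary.Construct.Closure.ReflexiveTransitive
  using (Star; ε; _◅_)
open import Relation.Binary.Core using (Rel)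
open import Relation.Binary.PropositionalEquality.Core using (_≡_; _≢_)
open import Relation.Binary.Structures using (IsTotalOrder)
open import Relation.Nullary.Negation.Core using (¬_)
open import Relation.Unary using (Pred; _≐_)

------------------------------------------------------------------------
-- Graphs

-- A finite simple graph with node set Fin n and edge set Fin m.  The
-- edge e joins src e and tgt e; which of the two is called the source
-- carries no meaning, since everything below is stated through Joins.

record Graph (n m : ℕ) : Set where
  field
    src tgt : Fin m → Fin n

  Joins : Fin m → Fin n → Fin n → Set
  Joins e v w = (src e ≡ v × tgt e ≡ w) ⊎ (src e ≡ w × tgt e ≡ v)

  field
    loopless : ∀ e → src e ≢ tgt e
    simple   : ∀ {e e′ v w} → Joins e v w → Joins e′ v w → e ≡ e′

-- A set A of edges of a graph also stands for the spanning subgraph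
-- (V, A).  In particular, a pair of graphs (V, E) and (V, E′) with
-- E ⊆ E′ is a Graph n m with E′ = Fin m together with E : Subset m.

module _ {n m : ℕ} (G : Graph n m) where
  open Graph G

  Step : Subset m → Fin n → Fin n → Set
  Step A v w = ∃[ e ] e ∈ A × Joins e v w

  Walk : Subset m → Fin n → Fin n → Set
  Walk A = Star (Step A)

  edges : ∀ {A v w} → Walk A v w → List (Fin m)
  edges ε               = []
  edges ((e , _) ◅ walk) = e ∷ edges walk

  -- All nodes visited after the start, in order.
  laterNodes : ∀ {A v w} → Walk A v w → List (Fin n)
  laterNodes ε                   = []
  laterNodes (_◅_ {j = u} _ walk) = u ∷ laterNodes walk

  nodes : ∀ {A v w} → Walk A v w → List (Fin n)
  nodes {v = v} walk = v ∷ laterNodes walk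

  IsEdgeSetOf : ∀ {A v w} → Subset m → Walk A v w → Set
  IsEdgeSetOf S walk = ∀ e → (e ∈ S) ⇔ (e ListMembership.∈ edges walk)

  IsConnected : Subset m → Set
  IsConnected A = ∀ v w → Walk A v w

  IsPath : Subset m → Fin n → Fin n → Subset m → Set
  IsPath A v w P = Σ (Walk A v w) λ walk → Unique (nodes walk) × IsEdgeSetOf P walk

  -- A closed walk v₀, v₁, …, vₖ = v₀ with k ≥ 3 and v₁, …, vₖ distinct.
  IsCycle : Subset m → Subset m → Set
  IsCycle A C = ∃[ v ] Σ (Walk A v v) λ walk →
    Unique (laterNodes walk) × 3 ℕ.≤ length (edges walk) × IsEdgeSetOf C walk

  Separates : Subset m → Fin n → Fin n → Subset m → Set
  Separates A v w C = C ⊆ A × ¬ Walk (A ─ C) v w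

  IsCut : Subset m → Fin n → Fin n → Subset m → Set
  IsCut A v w C =
    Separates A v w C × (∀ D → D ⊆ C → Separates A v w D → D ≡ C)

  _isNodeOf_ : Fin n → Subset m → Set
  v isNodeOf C = ∃[ e ] e ∈ C × ∃[ w ] Joins e v w

  IsChordless : Subset m → Set
  IsChordless C =
    ∀ g v w → g ∉ C → Joins g v w → ¬ (v isNodeOf C × w isNodeOf C)

------------------------------------------------------------------------
-- Ordered fields

-- The real numbers enter only as scalars of ℝ^E′, and the only structure
-- used is that of an ordered field.

record OrderedField (c ℓ₁ ℓ₂ : Level) : Set (lsuc (c ⊔ ℓ₁ ⊔ ℓ₂)) where
  infix  8 -_
  infixl 7 _*_
  infixl 6 _+_
  infix  4 _≈_ _≤_
  field
    Carrier           : Set c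
    _≈_               : Rel Carrier ℓ₁
    _≤_               : Rel Carrier ℓ₂
    _+_ _*_           : Op₂ Carrier
    -_                : Op₁ Carrier
    0# 1#             : Carrier
    isCommutativeRing : IsCommutativeRing _≈_ _+_ _*_ -_ 0# 1#
    isTotalOrder      : IsTotalOrder _≈_ _≤_
    0≉1               : ¬ (0# ≈ 1#)
    inverse           : ∀ x → ¬ (x ≈ 0#) → ∃[ y ] x * y ≈ 1#
    +-monoʳ-≤         : ∀ x {y z} → y ≤ z → x + y ≤ x + z
    *-nonNegative     : ∀ {x y} → 0# ≤ x → 0# ≤ y → 0# ≤ x * y

  commutativeRing : CommutativeRing c ℓ₁
  commutativeRing = record { isCommutativeRing = isCommutativeRing }

  open CommutativeRing commutativeRing public
    using (_-_; +-commutativeMonoid)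

------------------------------------------------------------------------
-- Convex geometry in K^m

module Polyhedral {c ℓ₁ ℓ₂ : Level} (K : OrderedField c ℓ₁ ℓ₂) where
  open OrderedField K using (Carrier; _≈_; _≤_; _+_; _*_; 0#; 1#; +-commutativeMonoid)
  open CommutativeMonoidSum +-commutativeMonoid using (sum)

  infix 7 _∙_
  _∙_ : ∀ {m} → Vector Carrier m → Vector Carrier m → Carrier
  a ∙ x = sum (λ j → a j * x j)

  -- The combination ∑ᵢ λᵢ pᵢ.
  combination : ∀ {k m} → Vector Carrier k → Vector (Vector Carrier m) k → Vector Carrier m
  combination coeff p j = sum (λ i → coeff i * p i j)

  conv : ∀ {m ℓ} → Pred (Vector Carrier m) ℓ → Pred (Vector Carrier m) (c ⊔ ℓ₁ ⊔ ℓ₂ ⊔ ℓ)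
  conv {m} A x =
    ∃[ k ] Σ (Vector (Vector Carrier m) k) λ p → Σ (Vector Carrier k) λ coeff →
      (∀ i → A (p i)) × (∀ i → 0# ≤ coeff i) × sum coeff ≈ 1# ×
      (∀ j → x j ≈ combination coeff p j)

  AffinelyIndependent : ∀ {k m} → Vector (Vector Carrier m) k → Set (c ⊔ ℓ₁)
  AffinelyIndependent p = ∀ coeff → sum coeff ≈ 0# →
    (∀ j → combination coeff p j ≈ 0#) → ∀ i → coeff i ≈ 0#

  -- The affine dimension of A is d: the largest number of affinely
  -- independent points in A is d + 1.
  HasDim : ∀ {m ℓ} → Pred (Vector Carrier m) ℓ → ℕ → Set (c ⊔ ℓ₁ ⊔ ℓ)
  HasDim {m} A d =
    (Σ (Vector (Vector Carrier m) (suc d)) λ p →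
      (∀ i → A (p i)) × AffinelyIndependent p) ×
    (∀ k (p : Vector (Vector Carrier m) k) →
      (∀ i → A (p i)) → AffinelyIndependent p → k ℕ.≤ suc d)

  IsFace : ∀ {m ℓ ℓ′} → Pred (Vector Carrier m) ℓ → Pred (Vector Carrier m) ℓ′ →
           Set (c ⊔ ℓ₁ ⊔ ℓ₂ ⊔ ℓ ⊔ ℓ′)
  IsFace {m} F P = Σ (Vector Carrier m) λ a → ∃[ b ]
    (∀ x → P x → a ∙ x ≤ b) × (F ≐ λ x → P x × a ∙ x ≈ b)

  IsFacet : ∀ {m ℓ ℓ′} → Pred (Vector Carrier m) ℓ → Pred (Vector Carrier m) ℓ′ →
            Set (c ⊔ ℓ₁ ⊔ ℓ₂ ⊔ ℓ ⊔ ℓ′)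
  IsFacet F P = IsFace F P × ∃[ d ] HasDim P (suc d) × HasDim F d

------------------------------------------------------------------------
-- Lifted multicuts

module LiftedMulticut {c ℓ₁ ℓ₂ : Level} (K : OrderedField c ℓ₁ ℓ₂)
                      {n m : ℕ} (G′ : Graph n m) (E : Subset m) where
  open OrderedField K using (Carrier; _≈_; _≤_; _-_; 0#; 1#; +-commutativeMonoid)
  open CommutativeMonoidSum +-commutativeMonoid using (sum)
  open Graph G′ using (Joins)
  open Polyhedral K using (conv)

  sumOver : Subset m → Vector Carrier m → Carrier
  sumOver A x = sum (λ e → if lookup A e then x e else 0#)

  record X (x : Vector Carrier m) : Set (c ⊔ ℓ₁ ⊔ ℓ₂) where
    field
      binary : ∀ e → x e ≈ 0# ⊎ x e ≈ 1#
      cycle  : ∀ C → IsCycle G′ E C → ∀ e → e ∈ C → x e ≤ sumOver (C ∖ e) x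
      path   : ∀ f v w → f ∉ E → Joins f v w →
               ∀ P → IsPath G′ E v w P → x f ≤ sumOver P x
      cut    : ∀ f v w → f ∉ E → Joins f v w →
               ∀ C → IsCut G′ E v w C → 1# - x f ≤ sumOver C (λ e → 1# - x e)

  Ξ : Pred (Vector Carrier m) (c ⊔ ℓ₁ ⊔ ℓ₂)
  Ξ = conv X

  S-cycle : Fin m → Subset m → Pred (Vector Carrier m) (c ⊔ ℓ₁ ⊔ ℓ₂)
  S-cycle e C x = X x × x e ≈ sumOver (C ∖ e) x

  Σ-cycle : Fin m → Subset m → Pred (Vector Carrier m) (c ⊔ ℓ₁ ⊔ ℓ₂)
  Σ-cycle e C = conv (S-cycle e C)

  S-path : Fin m → Subset m → Pred (Vector Carrier m) (c ⊔ ℓ₁ ⊔ ℓ₂)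
  S-path f P x = X x × x f ≈ sumOver P x

  Σ-path : Fin m → Subset m → Pred (Vector Carrier m) (c ⊔ ℓ₁ ⊔ ℓ₂)
  Σ-path f P = conv (S-path f P)

{-# OPTIONS --safe #-}
module Submission where

open import Defs
open import Algebra.Bundles using (CommutativeRing)
import Algebra.Properties.Ring as RingProperties
import Algebra.Properties.Semiring.Mult.TCOptimised as Mult
import Algebra.Properties.Semiring.Sum as Sum
import Algebra.Solver.Ring as RingSolver
open import Algebra.Solver.Ring.AlmostCommutativeRing
  using (fromCommutativeRing; _-Raw-AlmostCommutative⟶_)
open import Data.Bool.Base using (Bool; true; false; if_then_else_; _∧_)
open import Data.Bool.Properties using () renaming (_≟_ to _≟ᵇ_)
open import Data.Empty using (⊥-elim)
open import Data.Fin.Base using (Fin; zero; suc; punchIn; punchOut)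
open import Data.Fin.Properties using (_≟_; any?; punchIn-punchOut; suc-injective)
open import Data.Fin.Subset using (Subset; _∈_; _∉_; _⊆_; _⊂_; _∪_; ⁅_⁆; _─_) renaming (_-_ to _∖_)
open import Data.Fin.Subset.Induction using (⊂-wellFounded; Acc; acc)
open import Data.Fin.Subset.Properties
  using (_∈?_; x∈p∪q⁺; x∈p∪q⁻; x∈⁅x⁆; x∈⁅y⁆⇒x≡y; x∈p∧x≢y⇒x∈p-y; x∈p∧x∉q⇒x∈p─q; p─q⊆p; ⊆-antisym; ⊆-trans; ⊆-refl)
open import Data.Integer.Base as ℤ using (ℤ; +_; -[1+_]; _⊖_)
import Data.Integer.Properties as ℤ
open import Data.Integer.Tactic.RingSolver using (solve-∀)
open import Data.List.Base using (List; []; _∷_; _++_; length; filter; allFin)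
import Data.List.Membership.DecPropositional as DecMembership
open import Data.List.Membership.Propositional using () renaming (_∈_ to _∈ˡ_; _∉_ to _∉ˡ_)
open import Data.List.Membership.Propositional.Properties
  using (∈-++⁺ˡ; ∈-++⁺ʳ; ∈-++⁻; ∈-filter⁺; ∈-filter⁻; ∈-allFin)
open import Data.List.Properties using (length-++; ++-identityʳ)
open import Data.List.Relation.Unary.All as All using ([]; _∷_)
open import Data.List.Relation.Unary.All.Properties using (¬Any⇒All¬; All¬⇒¬Any)
open import Data.List.Relation.Unary.AllPairs using ([]; _∷_)
open import Data.List.Relation.Unary.Any using (here; there)
open import Data.List.Relation.Unary.Unique.Propositional using (Unique)
import Data.List.Relation.Unary.Unique.Propositional.Properties as Unique
open import Data.Maybe.Base using (Maybe; just; nothing)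
open import Data.Nat.Base as ℕ using (ℕ; zero; suc; z≤n; s≤s)
import Data.Nat.Properties as ℕ
open import Data.Product.Base using (Σ; ∃-syntax; _×_; _,_; proj₁; proj₂)
open import Data.Sum.Base using (_⊎_; inj₁; inj₂; [_,_]′)
open import Data.Vec.Base as V using (lookup; tabulate)
open import Data.Vec.Functional using (Vector) renaming (_∷_ to infixr 5 _∷ᵛ_; tail to tailᵛ)
open import Data.Vec.Properties using (lookup⇒[]=; []=⇒lookup; lookup∘tabulate; ≡-dec)
open import Function.Base using (_∘_; id; case_of_)
open import Function.Bundles using (_⇔_; mk⇔; Equivalence)
open import Level using (Level)
open import Relation.Binary.Construct.Closure.ReflexiveTransitive as Star using (Star; ε; _◅_; _◅◅_)
open import Relation.Binary.Construct.Closure.ReflexiveTransitive.Properties using (◅◅-assoc)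
open import Relation.Binary.PropositionalEquality as ≡ using (_≡_; _≢_)
import Relation.Binary.Reasoning.Setoid as SetoidReasoning
open import Relation.Binary.Structures using (IsTotalOrder)
open import Relation.Nullary using (¬_; Dec; yes; no; does; contradiction; _×-dec_; _⊎-dec_; ¬?)
open import Relation.Nullary.Decidable using (dec-true; dec-false; decidable-stable)
open import Relation.Unary using (Pred)

-- For (a), C ∖ e is a path P joining the ends of f = e, so both parts are
-- one statement about a path P and an edge f ∉ P joining its ends.
--
-- If a chord g spans the subpath Q of P, every x in S also satisfies
-- x g = ∑_Q x, so Σ lies in two hyperplanes.  The all-ones vector and the
-- multicut contracting a single edge of P ∖ Q show that these cut the
-- dimension of Ξ by two.
--
-- If P ∪ f is chordless, all points needed are multicuts pt A B of
-- decompositions into two connected blocks A, B and singletons, where P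
-- either lies in one block or is split once between A and B.  Splitting P at
-- e instead of keeping it whole changes exactly e and f.  For a pair of nodes
-- a, b not both on P, inclusion–exclusion over blocks with and without a and
-- b isolates the edge ab.  So integer combinations of the points of S contain
-- a basis of the hyperplane x f = ∑_P x; elimination over ℤ then selects m
-- affinely independent points, without deciding equality in the field.

-- Linear algebra over an ordered field

-- With a chord no dimension is computed: `HasDim` hands over d + 1 independent points of Σ, and two
-- more points of Ξ already exceed the bound for Ξ. Without a chord, the inequality has no constant
-- term, so its hyperplane passes through the origin and one coordinate of S can be traded for the
-- affine condition. Then m linearly independent vectors of length m suffice, and the all-ones
-- vector, off the hyperplane, completes an affine basis of the ambient space.
--
-- Spanning is used in dual form: a functional nonzero on an integer combination is nonzero on one
-- of its points. Over ℤ this can be decided, and the point found is the next pivot;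
-- cross-multiplication avoids denominators.
--
-- The cut inequalities restrict the points: blocks must be connected in G, while a and b may be
-- adjacent in G′ only. For a, b off P the common part M of the four blocks must stay connected as a
-- and b come and go. It is built from paths of G leading from a and b to P or, if one of these
-- meets the other node first, from the path between a and b, with P as second block.

record Linear {r : ℕ} (φ : (Fin r → ℤ) → ℤ) : Set where
  field
    cong  : ∀ {x y} → (∀ i → x i ≡ y i) → φ x ≡ φ y
    add   : ∀ x y → φ (λ i → x i ℤ.+ y i) ≡ φ x ℤ.+ φ y
    scale : ∀ k x → φ (λ i → k ℤ.* x i) ≡ k ℤ.* φ x

unit : ∀ {r} → Fin r → Fin r → ℤ
unit i j = if does (i ≟ j) then + 1 else + 0

-- Dual form of "the vectors `vec s` span ℚ^r": only the zero functional kills them all. The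
-- positive form returns the index `s` that elimination needs as a pivot.
Detects : ∀ {r} {I : Set} → (I → Fin r → ℤ) → Set
Detects {r} vec = ∀ φ → Linear {r} φ → ∀ i → φ (unit i) ≢ + 0 → ∃[ s ] φ (vec s) ≢ + 0

module Scalars {c ℓ₁ ℓ₂ : Level} (K : OrderedField c ℓ₁ ℓ₂) where
  open OrderedField K using (_≤_; isTotalOrder; 0≉1; inverse; +-monoʳ-≤; *-nonNegative)
  open CommutativeRing (OrderedField.commutativeRing K) public
    hiding (zero; _-_)
  open OrderedField K using (_-_) public
  open Mult semiring using (×-homo-+; ×1-homo-*; 1+×) renaming (_×_ to infixr 8 _⨯_)
  open RingProperties ring
  open Sum semiring public using (sum; sum-cong-≋; ∑-distrib-+; ∑-comm; *-distribˡ-sum; sum-replicate-zero)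
  open IsTotalOrder isTotalOrder
    using (total; antisym; ≤-respˡ-≈; ≤-respʳ-≈) renaming (refl to ≤-refl; trans to ≤-trans; reflexive to ≤-reflexive) public
  open SetoidReasoning setoid

  -- The integers inside the field

  ι : ℤ → Carrier
  ι (+ n)    = n ⨯ 1#
  ι -[1+ n ] = - (suc n ⨯ 1#)

  ι-neg : ∀ n → ι (ℤ.- (+ n)) ≈ - (n ⨯ 1#)
  ι-neg zero    = sym -0#≈0#
  ι-neg (suc n) = refl

  ι-⊖ : ∀ k l → ι (k ⊖ l) ≈ k ⨯ 1# - l ⨯ 1#
  ι-⊖ k zero = begin
    k ⨯ 1#         ≈⟨ +-identityʳ _ ⟨
    k ⨯ 1# + 0#    ≈⟨ +-congˡ -0#≈0# ⟨
    k ⨯ 1# - 0#    ∎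
  ι-⊖ zero (suc l) = sym (+-identityˡ _)
  ι-⊖ (suc k) (suc l) = begin
    ι (suc k ⊖ suc l)                      ≡⟨ ≡.cong ι (ℤ.[1+m]⊖[1+n]≡m⊖n k l) ⟩
    ι (k ⊖ l)                              ≈⟨ ι-⊖ k l ⟩
    k ⨯ 1# - l ⨯ 1#                        ≈⟨ +-congʳ (+-identityˡ _) ⟨
    (0# + k ⨯ 1#) - l ⨯ 1#                 ≈⟨ +-congʳ (+-congʳ (-‿inverseʳ 1#)) ⟨
    (1# - 1# + k ⨯ 1#) - l ⨯ 1#            ≈⟨ +-congʳ (trans (+-assoc _ _ _) (trans (+-congˡ (+-comm _ _)) (sym (+-assoc _ _ _)))) ⟩
    (1# + k ⨯ 1# - 1#) - l ⨯ 1#            ≈⟨ +-assoc _ _ _ ⟩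
    1# + k ⨯ 1# + (- 1# - l ⨯ 1#)          ≈⟨ +-congˡ (-‿+-comm 1# _) ⟩
    1# + k ⨯ 1# - (1# + l ⨯ 1#)            ≈⟨ +-cong (1+× k 1#) (-‿cong (1+× l 1#)) ⟨
    suc k ⨯ 1# - suc l ⨯ 1#                ∎

  ι-+ : ∀ i j → ι (i ℤ.+ j) ≈ ι i + ι j
  ι-+ (+ k)      (+ l)      = ×-homo-+ 1# k l
  ι-+ (+ k)      -[1+ l ]   = ι-⊖ k (suc l)
  ι-+ -[1+ k ]   (+ l)      = trans (ι-⊖ l (suc k)) (+-comm _ _)
  ι-+ -[1+ k ]   -[1+ l ]   = begin
    - (suc (suc (k ℕ.+ l)) ⨯ 1#)   ≡⟨ ≡.cong (λ z → - (suc z ⨯ 1#)) (ℕ.+-suc k l) ⟨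
    - ((suc k ℕ.+ suc l) ⨯ 1#)     ≈⟨ -‿cong (×-homo-+ 1# (suc k) (suc l)) ⟩
    - (suc k ⨯ 1# + suc l ⨯ 1#)    ≈⟨ -‿+-comm _ _ ⟨
    - (suc k ⨯ 1#) - suc l ⨯ 1#    ∎

  ι-* : ∀ i j → ι (i ℤ.* j) ≈ ι i * ι j
  ι-* (+ k) (+ l) = trans (reflexive (≡.cong ι (ℤ.+◃n≡+n (k ℕ.* l)))) (×1-homo-* k l)
  ι-* (+ k) -[1+ l ] = begin
    ι (+ k ℤ.* -[1+ l ])          ≡⟨ ≡.cong ι (ℤ.-◃n≡-n (k ℕ.* suc l)) ⟩
    ι (ℤ.- (+ (k ℕ.* suc l)))     ≈⟨ ι-neg (k ℕ.* suc l) ⟩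
    - ((k ℕ.* suc l) ⨯ 1#)        ≈⟨ -‿cong (×1-homo-* k (suc l)) ⟩
    - (k ⨯ 1# * (suc l ⨯ 1#))     ≈⟨ -‿distribʳ-* _ _ ⟩
    k ⨯ 1# * - (suc l ⨯ 1#)       ∎
  ι-* -[1+ k ] (+ l) = begin
    ι (-[1+ k ] ℤ.* + l)          ≡⟨ ≡.cong ι (ℤ.-◃n≡-n (suc k ℕ.* l)) ⟩
    ι (ℤ.- (+ (suc k ℕ.* l)))     ≈⟨ ι-neg (suc k ℕ.* l) ⟩
    - ((suc k ℕ.* l) ⨯ 1#)        ≈⟨ -‿cong (×1-homo-* (suc k) l) ⟩
    - (suc k ⨯ 1# * (l ⨯ 1#))     ≈⟨ -‿distribˡ-* _ _ ⟩
    - (suc k ⨯ 1#) * (l ⨯ 1#)     ∎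
  ι-* -[1+ k ] -[1+ l ] = begin
    ι (-[1+ k ] ℤ.* -[1+ l ])              ≡⟨ ≡.cong ι (ℤ.+◃n≡+n (suc k ℕ.* suc l)) ⟩
    (suc k ℕ.* suc l) ⨯ 1#                 ≈⟨ ×1-homo-* (suc k) (suc l) ⟩
    suc k ⨯ 1# * (suc l ⨯ 1#)              ≈⟨ -‿involutive _ ⟨
    - - (suc k ⨯ 1# * (suc l ⨯ 1#))        ≈⟨ -‿cong (-‿distribʳ-* _ _) ⟩
    - (suc k ⨯ 1# * - (suc l ⨯ 1#))        ≈⟨ -‿distribˡ-* _ _ ⟩
    - (suc k ⨯ 1#) * - (suc l ⨯ 1#)        ∎

  ι-minus : ∀ i → ι (ℤ.- i) ≈ - ι i
  ι-minus (+ n)      = ι-neg n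
  ι-minus -[1+ n ]   = sym (-‿involutive _)

  private
    morphism : ℤ.+-*-rawRing -Raw-AlmostCommutative⟶ fromCommutativeRing (OrderedField.commutativeRing K)
    morphism = record
      { ⟦_⟧ = ι ; +-homo = ι-+ ; *-homo = ι-* ; -‿homo = ι-minus ; 0-homo = refl ; 1-homo = refl }

    ι≟ : ∀ i j → Maybe (ι i ≈ ι j)
    ι≟ i j with i ℤ.≟ j
    ... | yes ≡.refl = just refl
    ... | no _       = nothing

  open RingSolver ℤ.+-*-rawRing _ morphism ι≟ public
    using (solve; con; _:=_; _:+_; _:*_; _:-_; :-_)


  +-mono-≤ : ∀ {w x y z} → w ≤ x → y ≤ z → w + y ≤ x + z
  +-mono-≤ {w} {x} {y} {z} w≤x y≤z = ≤-trans (+-monoʳ-≤ w y≤z)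
    (≤-respˡ-≈ (+-comm z w) (≤-respʳ-≈ (+-comm z x) (+-monoʳ-≤ z w≤x)))

  0≤1 : 0# ≤ 1#
  0≤1 with total 0# 1#
  ... | inj₁ 0≤1 = 0≤1
  ... | inj₂ 1≤0 = ≤-respʳ-≈
      (solve 0 (:- con (+ 1) :* :- con (+ 1) := con (+ 1)) refl)
      (*-nonNegative 0≤-1 0≤-1)
    where
    0≤-1 : 0# ≤ - 1#
    0≤-1 = ≤-respˡ-≈ (-‿inverseˡ 1#) (≤-respʳ-≈ (+-identityʳ _) (+-monoʳ-≤ (- 1#) 1≤0))

  1≰0 : ¬ (1# ≤ 0#)
  1≰0 1≤0 = 0≉1 (antisym 0≤1 1≤0)

  0≤n⨯1 : ∀ n → 0# ≤ n ⨯ 1#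
  0≤n⨯1 zero    = ≤-refl
  0≤n⨯1 (suc n) = ≤-respˡ-≈ (+-identityˡ 0#) (≤-respʳ-≈ (sym (1+× n 1#)) (+-mono-≤ 0≤1 (0≤n⨯1 n)))

  -- Characteristic zero comes from the order: `n ⨯ 1#` is nonnegative, so a vanishing `suc n ⨯ 1#`
  -- would give 1 ≤ 0.
  suc⨯1≉0 : ∀ n → ¬ (suc n ⨯ 1# ≈ 0#)
  suc⨯1≉0 n eq = 1≰0 (≤-respˡ-≈ (+-identityʳ 1#)
    (≤-respʳ-≈ (trans (sym (1+× n 1#)) eq) (+-monoʳ-≤ 1# (0≤n⨯1 n))))

  ι≈0⇒≡0 : ∀ i → ι i ≈ 0# → i ≡ + 0
  ι≈0⇒≡0 (+ zero)   _  = ≡.refl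
  ι≈0⇒≡0 (+ suc n)  eq = ⊥-elim (suc⨯1≉0 n eq)
  ι≈0⇒≡0 -[1+ n ]   eq = ⊥-elim (suc⨯1≉0 n (trans (sym (-‿involutive _)) (trans (-‿cong eq) -0#≈0#)))

  -- Equality of field elements known to be integral thereby reduces to equality in ℤ, which is
  -- decidable.
  ι-injective : ∀ {i j} → ι i ≈ ι j → i ≡ j
  ι-injective {i} {j} eq = ℤ.i-j≡0⇒i≡j i j (ι≈0⇒≡0 (i ℤ.- j)
    (trans (ι-+ i (ℤ.- j)) (trans (+-cong eq (ι-minus j)) (-‿inverseʳ (ι j)))))

  x*y≈0⇒y≈0 : ∀ {x y} → ¬ (x ≈ 0#) → x * y ≈ 0# → y ≈ 0#
  x*y≈0⇒y≈0 {x} {y} x≉0 xy≈0 with inverse x x≉0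
  ... | z , xz≈1 = begin
    y             ≈⟨ *-identityˡ y ⟨
    1# * y        ≈⟨ *-congʳ xz≈1 ⟨
    x * z * y     ≈⟨ solve 3 (λ x y z → x :* z :* y := z :* (x :* y)) refl x y z ⟩
    z * (x * y)   ≈⟨ *-congˡ xy≈0 ⟩
    z * 0#        ≈⟨ zeroʳ z ⟩
    0#            ∎

  sum-≈0 : ∀ {k} (x : Vector Carrier k) → (∀ i → x i ≈ 0#) → sum x ≈ 0#
  sum-≈0 {k} x x≈0 = trans (sum-cong-≋ x≈0) (sum-replicate-zero k)

  open Polyhedral K

  -- Linear combinations and elimination

  ∑-scale : ∀ {k} a (c x : Vector Carrier k) →
            sum (λ i → a * c i * x i) ≈ a * sum (λ i → c i * x i)
  ∑-scale a c x = trans (sum-cong-≋ (λ i → *-assoc a (c i) (x i))) (sym (*-distribˡ-sum a (λ i → c i * x i)))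

  -- `a * x i - y i * b` is an entry after a fraction-free elimination step with pivot `a`. The
  -- dimension bound and the selection of independent vectors both rest on this expansion.
  ∑-pivot : ∀ {k} a b (c x y : Vector Carrier k) →
            sum (λ i → c i * (a * x i - y i * b)) ≈ a * sum (λ i → c i * x i) - sum (λ i → c i * y i) * b
  ∑-pivot {zero} a b c x y = solve 2 (λ a b → con (+ 0) := a :* con (+ 0) :- con (+ 0) :* b) refl a b
  ∑-pivot {suc k} a b c x y = trans (+-congˡ (∑-pivot a b (c ∘ suc) (x ∘ suc) (y ∘ suc)))
    (solve 7 (λ a b c₀ x₀ y₀ X Y → c₀ :* (a :* x₀ :- y₀ :* b) :+ (a :* X :- Y :* b)
                := a :* (c₀ :* x₀ :+ X) :- (c₀ :* y₀ :+ Y) :* b) refl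
       a b (c zero) (x zero) (y zero) _ _)

  ∙-combination : ∀ {k m} (a : Vector Carrier m) (c : Vector Carrier k) p →
                  a ∙ combination c p ≈ sum (λ i → c i * (a ∙ p i))
  ∙-combination a c p = begin
    sum (λ j → a j * sum (λ i → c i * p i j))     ≈⟨ sum-cong-≋ (λ j → *-distribˡ-sum (a j) (λ i → c i * p i j)) ⟩
    sum (λ j → sum (λ i → a j * (c i * p i j)))   ≈⟨ ∑-comm (λ j i → a j * (c i * p i j)) ⟩
    sum (λ i → sum (λ j → a j * (c i * p i j)))   ≈⟨ sum-cong-≋ (λ i → sum-cong-≋ (λ j → comm₃ (a j) (c i) (p i j))) ⟩
    sum (λ i → sum (λ j → c i * (a j * p i j)))   ≈⟨ sum-cong-≋ (λ i → *-distribˡ-sum (c i) (λ j → a j * p i j)) ⟨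
    sum (λ i → c i * (a ∙ p i))                   ∎
    where
    comm₃ : ∀ x y z → x * (y * z) ≈ y * (x * z)
    comm₃ = solve 3 (λ x y z → x :* (y :* z) := y :* (x :* z)) refl

  ∙-congʳ : ∀ {m} (a : Vector Carrier m) {x y} → (∀ j → x j ≈ y j) → a ∙ x ≈ a ∙ y
  ∙-congʳ a x≈y = sum-cong-≋ (λ j → *-congˡ (x≈y j))

  LinearlyIndependent : ∀ {k r} → Vector (Vector Carrier r) k → Set _
  LinearlyIndependent p = ∀ coeff → (∀ j → combination coeff p j ≈ 0#) → ∀ i → coeff i ≈ 0#

  ¬¬-∀ : ∀ {ℓ k} {P : Fin k → Set ℓ} → (∀ i → ¬ ¬ P i) → ¬ ¬ (∀ i → P i)
  ¬¬-∀ {k = zero}  _  ¬all = ¬all (λ ())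
  ¬¬-∀ {k = suc k} dn ¬all = dn zero λ p₀ → ¬¬-∀ (dn ∘ suc) λ ps →
    ¬all λ { zero → p₀ ; (suc i) → ps i }

  -- ≈ is not assumed decidable, so the pivot of the elimination step only
  -- exists up to double negation.
  independent⇒≤ : ∀ k r (p : Vector (Vector Carrier r) k) → LinearlyIndependent p → ¬ (r ℕ.< k)
  independent⇒≤ (suc k) zero p indep _ = 0≉1 (sym (indep (λ _ → 1#) (λ ()) zero))
  independent⇒≤ (suc k) (suc r) p indep (s≤s r<k) =
    -- A nonzero entry of `p zero` would leave `k` independent vectors of length `r`, against
    -- induction. So all entries vanish, up to double negation, and coefficient 1 on `p zero` alone
    -- is a nontrivial relation.
    ¬¬-∀ (λ j p₀j≉0 → independent⇒≤ k r (eliminate j) (eliminated j p₀j≉0) r<k) λ p₀≈0 →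
      0≉1 (sym (indep (1# ∷ᵛ λ _ → 0#)
        (λ j → trans (+-cong (trans (*-identityˡ _) (p₀≈0 j)) (sum-≈0 (λ i → 0# * p (suc i) j) (λ i → zeroˡ _))) (+-identityˡ 0#)) zero))
    where
    row : Fin (suc r) → Fin k → Fin (suc r) → Carrier
    row j i l = p zero j * p (suc i) l - p (suc i) j * p zero l
    eliminate : Fin (suc r) → Vector (Vector Carrier r) k
    eliminate j i l = row j i (punchIn j l)
    eliminated : ∀ j → ¬ (p zero j ≈ 0#) → LinearlyIndependent (eliminate j)
    eliminated j p₀j≉0 coeff rel i = x*y≈0⇒y≈0 p₀j≉0 (indep coeff′ rel′ (suc i))
      where
      coeff′ : Vector Carrier (suc k)
      -- Expanding a relation among the rows gives `p zero j` times a combination of the later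
      -- vectors, minus a multiple of `p zero`; these are its coefficients.
      coeff′ = - sum (λ i → coeff i * p (suc i) j) ∷ᵛ λ i → p zero j * coeff i
      row≈0 : ∀ l → Dec (j ≡ l) → sum (λ i → coeff i * row j i l) ≈ 0#
      row≈0 l (yes ≡.refl) = sum-≈0 _ λ i →
        solve 3 (λ c x y → c :* (x :* y :- y :* x) := con (+ 0)) refl (coeff i) (p zero j) (p (suc i) j)
      row≈0 l (no j≢l) = ≡.subst (λ l → sum (λ i → coeff i * row j i l) ≈ 0#) (punchIn-punchOut j≢l) (rel (punchOut j≢l))
      rel′ : ∀ l → combination coeff′ p l ≈ 0#
      rel′ l = begin
        - Y * p zero l + sum (λ i → p zero j * coeff i * p (suc i) l)
          ≈⟨ +-congˡ (∑-scale (p zero j) coeff (λ i → p (suc i) l)) ⟩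
        - Y * p zero l + p zero j * sum (λ i → coeff i * p (suc i) l)
          ≈⟨ solve 4 (λ Y b a X → :- Y :* b :+ a :* X := a :* X :- Y :* b) refl Y (p zero l) (p zero j) _ ⟩
        p zero j * sum (λ i → coeff i * p (suc i) l) - Y * p zero l
          ≈⟨ ∑-pivot (p zero j) (p zero l) coeff (λ i → p (suc i) l) (λ i → p (suc i) j) ⟨
        sum (λ i → coeff i * row j i l)
          ≈⟨ row≈0 l (j ≟ l) ⟩
        0# ∎
        where Y = sum (λ i → coeff i * p (suc i) j)

  -- Fraction-free Gaussian elimination driven by functionals. The first coordinate, as a
  -- functional, is nonzero on some `vec s₀`. `T` kills that vector and maps to the remaining
  -- coordinates; functionals there are pulled back along `T`, so detection is inherited. Pivots are
  -- nonzero integers and stay nonzero in the field.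
  select : ∀ r {I : Set} (vec : I → Fin r → ℤ) → Detects vec →
           Σ (Vector I r) λ t → LinearlyIndependent (λ i j → ι (vec (t i) j))
  select zero    vec _       = (λ ()) , λ _ _ ()
  select (suc r) vec detects = s₀ ∷ᵛ t , independent
    where
    pivot : ∃[ s ] vec s zero ≢ + 0
    pivot = detects (λ x → x zero)
      (record { cong = λ x≡y → x≡y zero ; add = λ _ _ → ≡.refl ; scale = λ _ _ → ≡.refl }) zero (λ ())
    s₀ = proj₁ pivot
    v = vec s₀
    T : (Fin (suc r) → ℤ) → Fin r → ℤ
    T x j = v zero ℤ.* x (suc j) ℤ.- x zero ℤ.* v (suc j)
    T-detects : Detects (T ∘ vec)
    T-detects φ lin i φᵢ≢0 = detects (φ ∘ T) lin′ (suc i) φT≢0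
      where
      open Linear lin
      T-add : ∀ a b x y x₀ y₀ → a ℤ.* (x ℤ.+ y) ℤ.- (x₀ ℤ.+ y₀) ℤ.* b ≡ (a ℤ.* x ℤ.- x₀ ℤ.* b) ℤ.+ (a ℤ.* y ℤ.- y₀ ℤ.* b)
      T-add = solve-∀
      T-scale : ∀ a b k x x₀ → a ℤ.* (k ℤ.* x) ℤ.- (k ℤ.* x₀) ℤ.* b ≡ k ℤ.* (a ℤ.* x ℤ.- x₀ ℤ.* b)
      T-scale = solve-∀
      lin′ : Linear (φ ∘ T)
      lin′ = record
        { cong  = λ x≡y → cong λ j → ≡.cong₂ (λ a b → v zero ℤ.* a ℤ.- b ℤ.* v (suc j)) (x≡y (suc j)) (x≡y zero)
        ; add   = λ x y → ≡.trans (cong λ j → T-add (v zero) (v (suc j)) (x (suc j)) (y (suc j)) (x zero) (y zero)) (add (T x) (T y))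
        ; scale = λ k x → ≡.trans (cong λ j → T-scale (v zero) (v (suc j)) k (x (suc j)) (x zero)) (scale k (T x))
        }
      T-unit : ∀ j → T (unit (suc i)) j ≡ v zero ℤ.* unit i j
      T-unit j = ℤ.+-identityʳ _
      φT≢0 : φ (T (unit (suc i))) ≢ + 0
      φT≢0 eq with ℤ.i*j≡0⇒i≡0∨j≡0 (v zero) (≡.trans (≡.sym (≡.trans (cong T-unit) (scale (v zero) (unit i)))) eq)
      ... | inj₁ v₀≡0 = proj₂ pivot v₀≡0
      ... | inj₂ φᵢ≡0 = φᵢ≢0 φᵢ≡0
    IH = select r (T ∘ vec) T-detects
    t = proj₁ IH
    independent : LinearlyIndependent (λ i j → ι (vec ((s₀ ∷ᵛ t) i) j))
    independent coeff rel = λ { zero → x*y≈0⇒y≈0 (proj₂ pivot ∘ ι≈0⇒≡0 (v zero)) v₀c₀≈0 ; (suc i) → tail≈0 i }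
      where
      w : Fin r → Fin (suc r) → Carrier
      w i j = ι (vec (t i) j)
      rest : Fin (suc r) → Carrier
      rest j = sum (λ i → coeff (suc i) * w i j)
      rest≈ : ∀ j → rest j ≈ - (coeff zero * ι (v j))
      rest≈ j = begin
        rest j                                                      ≈⟨ solve 2 (λ x y → x := (y :+ x) :- y) refl _ (coeff zero * ι (v j)) ⟩
        (coeff zero * ι (v j) + rest j) - coeff zero * ι (v j)      ≈⟨ +-congʳ (rel j) ⟩
        0# - coeff zero * ι (v j)                                   ≈⟨ +-identityˡ _ ⟩
        - (coeff zero * ι (v j))                                    ∎
      tail≈0 : ∀ i → coeff (suc i) ≈ 0#
      -- Cross-multiplying the columns `zero` and `suc j` eliminates `coeff zero` and leaves a
      -- relation among the images under `T`.
      tail≈0 = proj₂ IH (coeff ∘ suc) λ j → begin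
        sum (λ i → coeff (suc i) * ι (T (vec (t i)) j))
          ≈⟨ sum-cong-≋ (λ i → *-congˡ {coeff (suc i)} (ι-T (vec (t i)) j)) ⟩
        sum (λ i → coeff (suc i) * (ι (v zero) * w i (suc j) - w i zero * ι (v (suc j))))
          ≈⟨ ∑-pivot (ι (v zero)) (ι (v (suc j))) (coeff ∘ suc) (λ i → w i (suc j)) (λ i → w i zero) ⟩
        ι (v zero) * rest (suc j) - rest zero * ι (v (suc j))
          ≈⟨ +-cong (*-congˡ (rest≈ (suc j))) (-‿cong (*-congʳ (rest≈ zero))) ⟩
        ι (v zero) * - (coeff zero * ι (v (suc j))) - - (coeff zero * ι (v zero)) * ι (v (suc j))
          ≈⟨ solve 3 (λ a b c₀ → a :* (:- (c₀ :* b)) :- (:- (c₀ :* a)) :* b := con (+ 0)) refl (ι (v zero)) (ι (v (suc j))) (coeff zero) ⟩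
        0# ∎
        where
        ι-T : ∀ x j → ι (T x j) ≈ ι (v zero) * ι (x (suc j)) - ι (x zero) * ι (v (suc j))
        ι-T x j = trans (ι-+ (v zero ℤ.* x (suc j)) _)
          (+-cong (ι-* (v zero) (x (suc j))) (trans (ι-minus (x zero ℤ.* v (suc j))) (-‿cong (ι-* (x zero) (v (suc j))))))
      v₀c₀≈0 : ι (v zero) * coeff zero ≈ 0#
      v₀c₀≈0 = begin
        ι (v zero) * coeff zero               ≈⟨ *-comm _ _ ⟩
        coeff zero * ι (v zero)               ≈⟨ +-identityʳ _ ⟨
        coeff zero * ι (v zero) + 0#          ≈⟨ +-congˡ (sum-≈0 (λ i → coeff (suc i) * w i zero) (λ i → trans (*-congʳ (tail≈0 i)) (zeroˡ _))) ⟨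
        coeff zero * ι (v zero) + rest zero   ≈⟨ rel zero ⟩
        0#                                    ∎

  -- Affine independence and hyperplanes through the origin

  sum-single : ∀ {k} (x : Vector Carrier k) i → (∀ j → i ≢ j → x j ≈ 0#) → sum x ≈ x i
  sum-single x zero    x≈0 = trans (+-congˡ (sum-≈0 (tailᵛ x) (λ j → x≈0 (suc j) (λ ())))) (+-identityʳ _)
  sum-single x (suc i) x≈0 = trans (+-cong (x≈0 zero (λ ())) (sum-single (tailᵛ x) i (λ j i≢j → x≈0 (suc j) (i≢j ∘ suc-injective))))
    (+-identityˡ _)

  -- Applying the functional `a` to an affine relation leaves only `coeff zero * (a ∙ u)`, because
  -- `a` vanishes on every `p i`.
  affine-extend : ∀ {k m} (a u : Vector Carrier m) (p : Vector (Vector Carrier m) k) →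
                  (∀ i → a ∙ p i ≈ 0#) → ¬ (a ∙ u ≈ 0#) → AffinelyIndependent p → AffinelyIndependent (u ∷ᵛ p)
  affine-extend a u p ap≈0 au≉0 indep coeff sum≈0 rel = λ { zero → c₀≈0 ; (suc i) → indep (coeff ∘ suc) sum′≈0 rel′ i }
    where
    c₀≈0 : coeff zero ≈ 0#
    c₀≈0 = x*y≈0⇒y≈0 au≉0 (begin
      (a ∙ u) * coeff zero                                                   ≈⟨ *-comm _ _ ⟩
      coeff zero * (a ∙ u)                                                   ≈⟨ +-identityʳ _ ⟨
      coeff zero * (a ∙ u) + 0#
        ≈⟨ +-congˡ (sum-≈0 (λ i → coeff (suc i) * (a ∙ p i)) (λ i → trans (*-congˡ (ap≈0 i)) (zeroʳ _))) ⟨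
      coeff zero * (a ∙ u) + sum (λ i → coeff (suc i) * (a ∙ p i))           ≈⟨ ∙-combination a coeff (u ∷ᵛ p) ⟨
      a ∙ combination coeff (u ∷ᵛ p)                                          ≈⟨ sum-≈0 _ (λ j → trans (*-congˡ (rel j)) (zeroʳ (a j))) ⟩
      0#                                                                     ∎)
    sum′≈0 : sum (coeff ∘ suc) ≈ 0#
    sum′≈0 = trans (sym (+-identityˡ _)) (trans (+-congʳ (sym c₀≈0)) sum≈0)
    rel′ : ∀ j → combination (coeff ∘ suc) p j ≈ 0#
    rel′ j = trans (sym (+-identityˡ _)) (trans (+-congʳ (sym (trans (*-congʳ c₀≈0) (zeroˡ (u j))))) (rel j))

  -- On the hyperplane a ∙ x ≈ 0 with a f ≉ 0 the coordinate f carries no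
  -- information, so it can make room for the homogenising coordinate.
  homogenise : ∀ {m} → Fin m → Vector Carrier m → Vector Carrier m
  homogenise f x j = if does (f ≟ j) then 1# else x j

  -- At coordinate `f` the homogenised relation is `sum coeff ≈ 0#`; elsewhere it agrees with the
  -- affine relation.
  linear⇒affine : ∀ {k m} f (p : Vector (Vector Carrier m) k) →
                  LinearlyIndependent (homogenise f ∘ p) → AffinelyIndependent p
  linear⇒affine f p indep coeff sum≈0 rel = indep coeff rel′
    where
    rel′ : ∀ j → combination coeff (homogenise f ∘ p) j ≈ 0#
    rel′ j with f ≟ j
    ... | yes _ = trans (sum-cong-≋ (λ i → *-identityʳ (coeff i))) sum≈0
    ... | no _  = rel j

  -- The overwritten coordinate is recovered from `a ∙ y ≈ 0#`: once the other coordinates of `y`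
  -- vanish, only `a f * y f` remains.
  affine⇒linear : ∀ {k m} f (a : Vector Carrier m) (p : Vector (Vector Carrier m) k) → ¬ (a f ≈ 0#) →
                  (∀ i → a ∙ p i ≈ 0#) → AffinelyIndependent p → LinearlyIndependent (homogenise f ∘ p)
  affine⇒linear f a p af≉0 ap≈0 indep coeff rel = indep coeff sum≈0 rel′
    where
    y = combination coeff p
    sum≈0 : sum coeff ≈ 0#
    sum≈0 with f ≟ f | rel f
    ... | yes _  | eq = trans (sum-cong-≋ (λ i → sym (*-identityʳ (coeff i)))) eq
    ... | no f≢f | _  = contradiction ≡.refl f≢f
    y≈0 : ∀ j → f ≢ j → y j ≈ 0#
    y≈0 j f≢j with f ≟ j | rel j
    ... | yes f≡j | _  = contradiction f≡j f≢j
    ... | no _    | eq = eq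
    rel′ : ∀ j → y j ≈ 0#
    rel′ j with f ≟ j
    ... | no f≢j     = y≈0 j f≢j
    ... | yes ≡.refl = x*y≈0⇒y≈0 af≉0 (begin
      a f * y f                            ≈⟨ sum-single (λ j → a j * y j) f (λ j f≢j → trans (*-congˡ (y≈0 j f≢j)) (zeroʳ (a j))) ⟨
      a ∙ y                                ≈⟨ ∙-combination a coeff p ⟩
      sum (λ i → coeff i * (a ∙ p i))      ≈⟨ sum-≈0 _ (λ i → trans (*-congˡ (ap≈0 i)) (zeroʳ (coeff i))) ⟩
      0#                                   ∎)

  affine⇒≤ : ∀ {k m} (p : Vector (Vector Carrier m) k) → AffinelyIndependent p → k ℕ.≤ suc m
  affine⇒≤ {k} {m} p indep = ℕ.≮⇒≥ (independent⇒≤ k (suc m) (λ i → 1# ∷ᵛ p i) λ coeff rel →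
    indep coeff (trans (sum-cong-≋ (λ i → sym (*-identityʳ (coeff i)))) (rel zero)) (rel ∘ suc))

  -- The constant 1 replaces a coordinate instead of being added to them, so the bound is one lower
  -- than for arbitrary points.
  hyperplane⇒≤ : ∀ {k m} f (a : Vector Carrier m) (p : Vector (Vector Carrier m) k) → ¬ (a f ≈ 0#) →
                 (∀ i → a ∙ p i ≈ 0#) → AffinelyIndependent p → k ℕ.≤ m
  hyperplane⇒≤ {k} {m} f a p af≉0 ap≈0 indep =
    ℕ.≮⇒≥ (independent⇒≤ k m (homogenise f ∘ p) (affine⇒linear f a p af≉0 ap≈0 indep))

  -- Convex hulls and faces

  module _ {m : ℕ} {ℓ} {A : Pred (Vector Carrier m) ℓ} where

    conv-⊇ : ∀ {x} → A x → conv A x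
    conv-⊇ {x} Ax = 1 , (λ _ → x) , (λ _ → 1#) , (λ _ → Ax) , (λ _ → 0≤1) , +-identityʳ 1# ,
      λ j → sym (trans (+-identityʳ _) (*-identityˡ (x j)))

    ∙-conv-≈0 : ∀ a {x} → (∀ y → A y → a ∙ y ≈ 0#) → conv A x → a ∙ x ≈ 0#
    ∙-conv-≈0 a {x} aA≈0 (k , p , coeff , Ap , _ , _ , x≈) = begin
      a ∙ x                              ≈⟨ ∙-congʳ a x≈ ⟩
      a ∙ combination coeff p            ≈⟨ ∙-combination a coeff p ⟩
      sum (λ i → coeff i * (a ∙ p i))    ≈⟨ sum-≈0 _ (λ i → trans (*-congˡ (aA≈0 (p i) (Ap i))) (zeroʳ (coeff i))) ⟩
      0#                                 ∎

  sum≤0 : ∀ {k} (x : Vector Carrier k) → (∀ i → x i ≤ 0#) → sum x ≤ 0#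
  sum≤0 {zero}  x _   = ≤-refl
  sum≤0 {suc k} x x≤0 = ≤-respʳ-≈ (+-identityˡ 0#) (+-mono-≤ (x≤0 zero) (sum≤0 (tailᵛ x) (x≤0 ∘ suc)))

  sum-≈0⇒≈0 : ∀ {k} (x : Vector Carrier k) → (∀ i → x i ≤ 0#) → sum x ≈ 0# → ∀ i → x i ≈ 0#
  sum-≈0⇒≈0 {suc k} x x≤0 sum≈0 = λ { zero → x₀≈0 ; (suc i) → sum-≈0⇒≈0 (tailᵛ x) (x≤0 ∘ suc) rest≈0 i }
    where
    x₀≈0 : x zero ≈ 0#
    x₀≈0 = antisym (x≤0 zero) (≤-respˡ-≈ sum≈0 (≤-respʳ-≈ (+-identityʳ _) (+-monoʳ-≤ (x zero) (sum≤0 (tailᵛ x) (x≤0 ∘ suc)))))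
    rest≈0 : sum (tailᵛ x) ≈ 0#
    rest≈0 = trans (sym (+-identityˡ _)) (trans (+-congʳ (sym x₀≈0)) sum≈0)

  *-nonPositive : ∀ {x y} → 0# ≤ x → y ≤ 0# → x * y ≤ 0#
  *-nonPositive {x} {y} 0≤x y≤0 = ≤-respˡ-≈ (+-identityʳ _) (≤-respʳ-≈ (trans (+-congˡ (sym (-‿distribʳ-* x y))) (-‿inverseʳ _))
    (+-monoʳ-≤ (x * y) (*-nonNegative 0≤x 0≤-y)))
    where
    0≤-y : 0# ≤ - y
    0≤-y = ≤-respˡ-≈ (-‿inverseˡ y) (≤-respʳ-≈ (+-identityʳ _) (+-monoʳ-≤ (- y) y≤0))

  -- `a` is nonpositive on `A`, so a convex combination on the face gives weight only to tight
  -- points. Tightness is decided only at points of `A`, which have integral values in the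
  -- application.
  conv-face : ∀ {m ℓ ℓ′} {A : Pred (Vector Carrier m) ℓ} {B : Pred (Vector Carrier m) ℓ′} a z →
              (∀ x → A x → a ∙ x ≤ 0#) → (∀ x → A x → Dec (a ∙ x ≈ 0#)) →
              (∀ x → B x → A x × a ∙ x ≈ 0#) → (∀ x → A x → a ∙ x ≈ 0# → B x) → B z →
              IsFace (conv B) (conv A)
  conv-face {m} {A = A} {B} a z valid dec B⇒ ⇒B Bz = a , 0# , valid′ , ⊆-face , ⊇-face
    where
    valid′ : ∀ x → conv A x → a ∙ x ≤ 0#
    valid′ x (k , p , coeff , Ap , 0≤coeff , _ , x≈) =
      ≤-respˡ-≈ (sym (trans (∙-congʳ a x≈) (∙-combination a coeff p)))
        (sum≤0 (λ i → coeff i * (a ∙ p i)) λ i → *-nonPositive (0≤coeff i) (valid (p i) (Ap i)))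
    ⊆-face : ∀ {x} → conv B x → conv A x × a ∙ x ≈ 0#
    ⊆-face Bx@(k , p , coeff , Bp , rest) =
      (k , p , coeff , (λ i → proj₁ (B⇒ (p i) (Bp i))) , rest) , ∙-conv-≈0 a (λ y By → proj₂ (B⇒ y By)) Bx
    -- Points off the face have coefficient 0 and may be replaced by z.
    ⊇-face : ∀ {x} → conv A x × a ∙ x ≈ 0# → conv B x
    ⊇-face {x} ((k , p , coeff , Ap , 0≤coeff , sum≈1 , x≈) , ax≈0) =
      k , q , coeff , Bq , 0≤coeff , sum≈1 , λ j → trans (x≈ j) (sum-cong-≋ (λ i → proj₂ (proj₂ (moved i)) j))
      where
      terms≈0 : ∀ i → coeff i * (a ∙ p i) ≈ 0#
      terms≈0 = sum-≈0⇒≈0 (λ i → coeff i * (a ∙ p i)) (λ i → *-nonPositive (0≤coeff i) (valid (p i) (Ap i)))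
        (trans (sym (trans (∙-congʳ a x≈) (∙-combination a coeff p))) ax≈0)
      moved : ∀ i → Σ (Vector Carrier m) λ q → B q × (∀ j → coeff i * p i j ≈ coeff i * q j)
      moved i with dec (p i) (Ap i)
      ... | yes ap≈0 = p i , ⇒B (p i) (Ap i) ap≈0 , λ j → refl
      ... | no ap≉0 = z , Bz , λ j → trans (trans (*-congʳ cᵢ≈0) (zeroˡ _)) (sym (trans (*-congʳ cᵢ≈0) (zeroˡ _)))
        where
        cᵢ≈0 : coeff i ≈ 0#
        cᵢ≈0 = x*y≈0⇒y≈0 ap≉0 (trans (*-comm _ _) (terms≈0 i))
      q : Vector (Vector Carrier m) k
      q i = proj₁ (moved i)
      Bq : ∀ i → B (q i)
      Bq i = proj₁ (proj₂ (moved i))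

  0≤sum : ∀ {k} (x : Vector Carrier k) → (∀ i → 0# ≤ x i) → 0# ≤ sum x
  0≤sum {zero}  x _   = ≤-refl
  0≤sum {suc k} x 0≤x = ≤-respˡ-≈ (+-identityˡ 0#) (+-mono-≤ (0≤x zero) (0≤sum (tailᵛ x) (0≤x ∘ suc)))

  term≤sum : ∀ {k} (x : Vector Carrier k) → (∀ i → 0# ≤ x i) → ∀ i → x i ≤ sum x
  term≤sum {suc k} x 0≤x zero    = ≤-respˡ-≈ (+-identityʳ _) (+-monoʳ-≤ (x zero) (0≤sum (tailᵛ x) (0≤x ∘ suc)))
  term≤sum {suc k} x 0≤x (suc i) = ≤-respˡ-≈ (+-identityˡ _) (+-mono-≤ (0≤x zero) (term≤sum (tailᵛ x) (0≤x ∘ suc) i))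

-- Walks and connected sets of nodes

module _ {k : ℕ} where

  open DecMembership (_≟_ {k}) using () renaming (_∈?_ to _∈ˡ?_) public

  unique-++ˡ : ∀ xs {ys : List (Fin k)} → Unique (xs ++ ys) → Unique xs
  unique-++ˡ []       _            = []
  unique-++ˡ (x ∷ xs) (x∉ ∷ uniq) = All.tabulate (λ y∈ → All.lookup x∉ (∈-++⁺ˡ y∈)) ∷ unique-++ˡ xs uniq

  unique-++ʳ : ∀ xs {ys : List (Fin k)} → Unique (xs ++ ys) → Unique ys
  unique-++ʳ []       uniq       = uniq
  unique-++ʳ (x ∷ xs) (_ ∷ uniq) = unique-++ʳ xs uniq

  unique-disjoint : ∀ xs {ys : List (Fin k)} → Unique (xs ++ ys) → ∀ {a} → a ∈ˡ xs → a ∉ˡ ys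
  unique-disjoint (x ∷ xs) (x∉ ∷ uniq) (here ≡.refl) a∈ys = All.lookup x∉ (∈-++⁺ʳ xs a∈ys) ≡.refl
  unique-disjoint (x ∷ xs) (x∉ ∷ uniq) (there a∈xs)  a∈ys = unique-disjoint xs uniq a∈xs a∈ys

  unique-swap : ∀ xs {ys : List (Fin k)} → Unique (xs ++ ys) → Unique (ys ++ xs)
  unique-swap xs uniq = Unique.++⁺ (unique-++ʳ xs uniq) (unique-++ˡ xs uniq)
    (λ (a∈ys , a∈xs) → unique-disjoint xs uniq a∈xs a∈ys)

  unique-∷ : ∀ {x} {xs : List (Fin k)} → x ∉ˡ xs → Unique xs → Unique (x ∷ xs)
  unique-∷ x∉xs uniq = ¬Any⇒All¬ _ x∉xs ∷ uniq

  unique-head : ∀ {x} {xs : List (Fin k)} → Unique (x ∷ xs) → x ∉ˡ xs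
  unique-head (x∉ ∷ _) = All¬⇒¬Any x∉

  ∈-tabulate⁺ : ∀ {p : Fin k → Bool} {e} → p e ≡ true → e ∈ tabulate p
  ∈-tabulate⁺ {p} {e} pe = lookup⇒[]= e _ (≡.trans (lookup∘tabulate p e) pe)

  ∈-tabulate⁻ : ∀ {p : Fin k → Bool} {e} → e ∈ tabulate p → p e ≡ true
  ∈-tabulate⁻ {p} {e} e∈ = ≡.trans (≡.sym (lookup∘tabulate p e)) ([]=⇒lookup e∈)

  fromList : List (Fin k) → Subset k
  fromList xs = tabulate (λ e → does (e ∈ˡ? xs))

  ∈-fromList : ∀ xs e → (e ∈ fromList xs) ⇔ (e ∈ˡ xs)
  ∈-fromList xs e = mk⇔ to (λ e∈xs → ∈-tabulate⁺ (dec-true (e ∈ˡ? xs) e∈xs))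
    where
    to : e ∈ fromList xs → e ∈ˡ xs
    to e∈ with e ∈ˡ? xs | ∈-tabulate⁻ {λ e → does (e ∈ˡ? xs)} e∈
    ... | yes e∈xs | _ = e∈xs

  x∉p∖x : ∀ (p : Subset k) x → x ∉ p ∖ x
  x∉p∖x p x x∈ = ¬∈ p x∈
    where
    ¬∈ : ∀ {k} (p : Subset k) {x} → x ∉ p ∖ x
    ¬∈ (_ V.∷ p) {suc x} (V.there x∈) = ¬∈ p x∈

  x∈p─q⇒x∉q : ∀ (p q : Subset k) {x} → x ∈ p ─ q → x ∉ q
  x∈p─q⇒x∉q p q x∈ x∈q = go p q x∈ x∈q
    where
    go : ∀ {k} (p q : Subset k) {x} → x ∈ p ─ q → x ∉ q
    go (_ V.∷ p) (true V.∷ q)  {zero}  ()         x∈q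
    go (_ V.∷ p) (false V.∷ q) {zero}  _          ()
    go (_ V.∷ p) (true V.∷ q)  {suc x} (V.there x∈) (V.there x∈q) = go p q x∈ x∈q
    go (_ V.∷ p) (false V.∷ q) {suc x} (V.there x∈) (V.there x∈q) = go p q x∈ x∈q

  ⊆∧≢⇒⊂ : ∀ {p q : Subset k} → p ⊆ q → p ≢ q → p ⊂ q
  ⊆∧≢⇒⊂ {p} {q} p⊆q p≢q with any? (λ x → x ∈? q ×-dec ¬? (x ∈? p))
  ... | yes (x , x∈q , x∉p) = p⊆q , x , x∈q , x∉p
  ... | no ¬∃ = contradiction (⊆-antisym p⊆q λ {x} x∈q → decidable-stable (x ∈? p) λ x∉p → ¬∃ (x , x∈q , x∉p)) p≢q

-- Walks, paths and cycles

module Walks {n m : ℕ} (G : Graph n m) where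
  open Graph G

  joins-sym : ∀ {e v w} → Joins e v w → Joins e w v
  joins-sym (inj₁ (s , t)) = inj₂ (s , t)
  joins-sym (inj₂ (s , t)) = inj₁ (s , t)

  joins-irrefl : ∀ {e v} → ¬ Joins e v v
  joins-irrefl {e} (inj₁ (s , t)) = loopless e (≡.trans s (≡.sym t))
  joins-irrefl {e} (inj₂ (s , t)) = loopless e (≡.trans s (≡.sym t))

  joins-≢ : ∀ {e v w} → Joins e v w → v ≢ w
  joins-≢ joins ≡.refl = joins-irrefl joins

  joins-ends : ∀ {e a b c d} → Joins e a b → Joins e c d → (a ≡ c × b ≡ d) ⊎ (a ≡ d × b ≡ c)
  joins-ends (inj₁ (≡.refl , ≡.refl)) (inj₁ (≡.refl , ≡.refl)) = inj₁ (≡.refl , ≡.refl)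
  joins-ends (inj₁ (≡.refl , ≡.refl)) (inj₂ (≡.refl , ≡.refl)) = inj₂ (≡.refl , ≡.refl)
  joins-ends (inj₂ (≡.refl , ≡.refl)) (inj₁ (≡.refl , ≡.refl)) = inj₂ (≡.refl , ≡.refl)
  joins-ends (inj₂ (≡.refl , ≡.refl)) (inj₂ (≡.refl , ≡.refl)) = inj₁ (≡.refl , ≡.refl)

  joins-self : ∀ e → Joins e (src e) (tgt e)
  joins-self e = inj₁ (≡.refl , ≡.refl)

  step-sym : ∀ {A u v} → Step G A u v → Step G A v u
  step-sym (e , e∈A , joins) = e , e∈A , joins-sym joins

  weaken : ∀ {A B u v} → A ⊆ B → Walk G A u v → Walk G B u v
  weaken A⊆B = Star.map λ (e , e∈A , joins) → e , A⊆B e∈A , joins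

  edges-weaken : ∀ {A B u v} (A⊆B : A ⊆ B) (p : Walk G A u v) → edges G (weaken A⊆B p) ≡ edges G p
  edges-weaken A⊆B ε       = ≡.refl
  edges-weaken A⊆B (s ◅ p) = ≡.cong (_ ∷_) (edges-weaken A⊆B p)

  laterNodes-weaken : ∀ {A B u v} (A⊆B : A ⊆ B) (p : Walk G A u v) → laterNodes G (weaken A⊆B p) ≡ laterNodes G p
  laterNodes-weaken A⊆B ε       = ≡.refl
  laterNodes-weaken A⊆B (s ◅ p) = ≡.cong (_ ∷_) (laterNodes-weaken A⊆B p)

  module _ {A : Subset m} where

    edges-◅◅ : ∀ {u v w} (p : Walk G A u v) (q : Walk G A v w) → edges G (p ◅◅ q) ≡ edges G p ++ edges G q
    edges-◅◅ ε       q = ≡.refl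
    edges-◅◅ (s ◅ p) q = ≡.cong (_ ∷_) (edges-◅◅ p q)

    laterNodes-◅◅ : ∀ {u v w} (p : Walk G A u v) (q : Walk G A v w) →
                    laterNodes G (p ◅◅ q) ≡ laterNodes G p ++ laterNodes G q
    laterNodes-◅◅ ε       q = ≡.refl
    laterNodes-◅◅ (s ◅ p) q = ≡.cong (_ ∷_) (laterNodes-◅◅ p q)

    nodes-◅◅ : ∀ {u v w} (p : Walk G A u v) (q : Walk G A v w) → nodes G (p ◅◅ q) ≡ nodes G p ++ laterNodes G q
    nodes-◅◅ p q = ≡.cong (_ ∷_) (laterNodes-◅◅ p q)

    nodes-◅◅-◅ : ∀ {u v w x} (p : Walk G A u v) (s : Step G A v w) (q : Walk G A w x) →
                 nodes G (p ◅◅ s ◅ q) ≡ nodes G p ++ nodes G q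
    nodes-◅◅-◅ p s q = nodes-◅◅ p (s ◅ q)

    initNodes : ∀ {u v} → Walk G A u v → List (Fin n)
    initNodes ε           = []
    initNodes {u} (s ◅ p) = u ∷ initNodes p

    nodes-init : ∀ {u v w} (p : Walk G A u v) (q : Walk G A v w) → nodes G (p ◅◅ q) ≡ initNodes p ++ nodes G q
    nodes-init ε       q = ≡.refl
    nodes-init (s ◅ p) q = ≡.cong (_ ∷_) (nodes-init p q)

    last∈nodes : ∀ {u v} (p : Walk G A u v) → v ∈ˡ nodes G p
    last∈nodes ε       = here ≡.refl
    last∈nodes (s ◅ p) = there (last∈nodes p)

    edges⊆ : ∀ {u v} (p : Walk G A u v) {e} → e ∈ˡ edges G p → e ∈ A
    edges⊆ ((_ , e∈A , _) ◅ p) (here ≡.refl) = e∈A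
    edges⊆ (_ ◅ p)             (there e∈)    = edges⊆ p e∈

    ends∈nodes : ∀ {u v} (p : Walk G A u v) {e a b} → e ∈ˡ edges G p → Joins e a b → a ∈ˡ nodes G p × b ∈ˡ nodes G p
    ends∈nodes ((_ , _ , joins) ◅ p) (here ≡.refl) joins′ with joins-ends joins joins′
    ... | inj₁ (≡.refl , ≡.refl) = here ≡.refl , there (here ≡.refl)
    ... | inj₂ (≡.refl , ≡.refl) = there (here ≡.refl) , here ≡.refl
    ends∈nodes (_ ◅ p) (there e∈) joins′ with ends∈nodes p e∈ joins′
    ... | a∈ , b∈ = there a∈ , there b∈

    unique-edges : ∀ {u v} (p : Walk G A u v) → Unique (nodes G p) → Unique (edges G p)
    unique-edges ε _ = []
    unique-edges (s@(_ , _ , joins) ◅ p) uniq@(_ ∷ uniq′) =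
      unique-∷ (λ e∈ → unique-head uniq (proj₁ (ends∈nodes p e∈ joins))) (unique-edges p uniq′)

    splitNode : ∀ {u v a} (p : Walk G A u v) → a ∈ˡ nodes G p →
                Σ (Walk G A u a) λ p₁ → Σ (Walk G A a v) λ p₂ → p ≡ p₁ ◅◅ p₂
    splitNode p       (here ≡.refl) = ε , p , ≡.refl
    splitNode (s ◅ p) (there a∈) with splitNode p a∈
    ... | p₁ , p₂ , eq = s ◅ p₁ , p₂ , ≡.cong (s ◅_) eq

    splitEdge : ∀ {u v e} (p : Walk G A u v) → e ∈ˡ edges G p →
                ∃[ a ] ∃[ b ] Σ (Walk G A u a) λ p₁ → Σ (e ∈ A × Joins e a b) λ s → Σ (Walk G A b v) λ p₂ →
                p ≡ p₁ ◅◅ (e , s) ◅ p₂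
    splitEdge ((_ , s) ◅ p) (here ≡.refl) = _ , _ , ε , s , p , ≡.refl
    splitEdge (s ◅ p)       (there e∈) with splitEdge p e∈
    ... | a , b , p₁ , s′ , p₂ , eq = a , b , s ◅ p₁ , s′ , p₂ , ≡.cong (s ◅_) eq

    -- Loop erasure: when the start recurs, everything before its recurrence is dropped. The
    -- inclusion of nodes keeps the path clear of sets that the walk avoids.
    toPath : ∀ {u v} (p : Walk G A u v) →
             Σ (Walk G A u v) λ q → Unique (nodes G q) × (∀ {x} → x ∈ˡ nodes G q → x ∈ˡ nodes G p)
    toPath ε = ε , [] ∷ [] , id
    toPath {u} (s ◅ p) with toPath p
    ... | q , uniq , q⊆p with u ∈ˡ? nodes G q
    ...   | no u∉q = s ◅ q , unique-∷ u∉q uniq , λ { (here x≡u) → here x≡u ; (there x∈q) → there (q⊆p x∈q) }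
    ...   | yes u∈q with splitNode q u∈q
    ...     | q₁ , q₂ , ≡.refl = q₂ , unique-++ʳ (initNodes q₁) (≡.subst Unique (nodes-init q₁ q₂) uniq) ,
      λ x∈ → there (q⊆p (≡.subst (_ ∈ˡ_) (≡.sym (nodes-init q₁ q₂)) (∈-++⁺ʳ (initNodes q₁) x∈)))

  data Unsnoc {A : Subset m} {u} : ∀ {v} → Walk G A u v → Set where
    nil  : Unsnoc ε
    snoc : ∀ {v w} (p : Walk G A u v) (s : Step G A v w) → Unsnoc (p ◅◅ s ◅ ε)

  unsnoc : ∀ {A u v} (p : Walk G A u v) → Unsnoc p
  unsnoc ε = nil
  unsnoc (s ◅ p) with unsnoc p
  ... | nil      = snoc ε s
  ... | snoc q t = snoc (s ◅ q) t

  -- As first edge it already reaches the end of the path; as a later edge it would return to the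
  -- start.
  closing-edge : ∀ {A e u v} (p : Walk G A u v) → Unique (nodes G p) → Joins e u v → e ∈ˡ edges G p →
                 length (edges G p) ≡ 1
  closing-edge (s@(_ , _ , joins′) ◅ p) uniq joins (here ≡.refl) with joins-ends joins joins′
  ... | inj₂ (_ , ≡.refl) = ⊥-elim (unique-head uniq (last∈nodes p))
  ... | inj₁ (_ , ≡.refl) with p
  ...   | ε     = ≡.refl
  ...   | _ ◅ q = ⊥-elim (unique-head (tail uniq) (last∈nodes q))
    where
    tail : ∀ {x} {xs : List (Fin n)} → Unique (x ∷ xs) → Unique xs
    tail (_ ∷ uniq) = uniq
  closing-edge (s ◅ p) uniq joins (there e∈) = ⊥-elim (unique-head uniq (proj₁ (ends∈nodes p e∈ joins)))

  -- The closed walk is opened at `e` and rotated, so that the part after `e` comes first.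
  cycle⇒path : ∀ {A C e} → IsCycle G A C → e ∈ C → ∃[ v ] ∃[ w ] Joins e v w × IsPath G A v w (C ∖ e)
  cycle⇒path {A} {C} {e} (x , p , uniq , 3≤ , isC) e∈C with splitEdge p (Equivalence.to (isC e) e∈C)
  ... | a , b , p₁ , (e∈A , joins) , p₂ , ≡.refl =
    b , a , joins-sym joins , p₂ ◅◅ p₁ , uniq′ , λ d → mk⇔ (to d) (from d)
    where
    uniq′ : Unique (nodes G (p₂ ◅◅ p₁))
    uniq′ = ≡.subst Unique (≡.cong (b ∷_) (≡.sym (laterNodes-◅◅ p₂ p₁)))
      (unique-swap (laterNodes G p₁) (≡.subst Unique (laterNodes-◅◅ p₁ ((e , e∈A , joins) ◅ p₂)) uniq))
    edges-p : edges G (p₁ ◅◅ (e , e∈A , joins) ◅ p₂) ≡ edges G p₁ ++ e ∷ edges G p₂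
    edges-p = edges-◅◅ p₁ _
    -- If `e` occurred on the rest of the cycle, `closing-edge` would leave a rest of one edge,
    -- hence a cycle of two edges instead of at least three.
    length≢1 : length (edges G (p₂ ◅◅ p₁)) ≢ 1
    length≢1 eq = case ≡.subst (3 ℕ.≤_) total 3≤ of λ { (s≤s (s≤s ())) }
      where
      total : length (edges G (p₁ ◅◅ (e , e∈A , joins) ◅ p₂)) ≡ 2
      total = ≡.trans (≡.cong length edges-p) (≡.trans (length-++ (edges G p₁)) (≡.trans (ℕ.+-suc (length (edges G p₁)) _)
        (≡.cong suc (≡.trans (ℕ.+-comm (length (edges G p₁)) _) (≡.trans (≡.sym (≡.trans (≡.cong length (edges-◅◅ p₂ p₁)) (length-++ (edges G p₂)))) eq)))))
    e∉ : e ∉ˡ edges G (p₂ ◅◅ p₁)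
    e∉ e∈ = length≢1 (closing-edge (p₂ ◅◅ p₁) uniq′ (joins-sym joins) e∈)
    to : ∀ d → d ∈ C ∖ e → d ∈ˡ edges G (p₂ ◅◅ p₁)
    to d d∈ with ∈-++⁻ (edges G p₁) (≡.subst (d ∈ˡ_) edges-p (Equivalence.to (isC d) (p─q⊆p C ⁅ e ⁆ d∈)))
    ... | inj₁ d∈₁            = ≡.subst (d ∈ˡ_) (≡.sym (edges-◅◅ p₂ p₁)) (∈-++⁺ʳ (edges G p₂) d∈₁)
    ... | inj₂ (here ≡.refl)  = ⊥-elim (x∉p∖x C e d∈)
    ... | inj₂ (there d∈₂)    = ≡.subst (d ∈ˡ_) (≡.sym (edges-◅◅ p₂ p₁)) (∈-++⁺ˡ d∈₂)
    from : ∀ d → d ∈ˡ edges G (p₂ ◅◅ p₁) → d ∈ C ∖ e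
    from d d∈ = x∈p∧x≢y⇒x∈p-y (Equivalence.from (isC d) d∈C) (λ { ≡.refl → e∉ d∈ })
      where
      d∈C : d ∈ˡ edges G (p₁ ◅◅ (e , e∈A , joins) ◅ p₂)
      d∈C with ∈-++⁻ (edges G p₂) (≡.subst (d ∈ˡ_) (edges-◅◅ p₂ p₁) d∈)
      ... | inj₁ d∈₂ = ≡.subst (d ∈ˡ_) (≡.sym edges-p) (∈-++⁺ʳ (edges G p₁) (there d∈₂))
      ... | inj₂ d∈₁ = ≡.subst (d ∈ˡ_) (≡.sym edges-p) (∈-++⁺ˡ d∈₁)

  path⇒cycle : ∀ {A v w f P} → IsPath G A v w P → Joins f v w → f ∈ A → f ∉ P → IsCycle G A (P ∪ ⁅ f ⁆)
  path⇒cycle {A} {v} {w} {f} {P} (p , uniq , isP) joins f∈A f∉P =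
    w , (f , f∈A , joins-sym joins) ◅ p , uniq , s≤s (2≤ p isP joins) , λ d → mk⇔ (to d) (from d)
    where
    -- A single edge parallel to `f` would be `f` itself by simplicity, so the path has two edges
    -- and the cycle three.
    2≤ : ∀ {u} (p : Walk G A u w) → IsEdgeSetOf G P p → Joins f u w → 2 ℕ.≤ length (edges G p)
    2≤ ε _ joins = ⊥-elim (joins-irrefl joins)
    2≤ ((e , _ , joins′) ◅ ε) isP joins =
      ⊥-elim (f∉P (≡.subst (_∈ P) (simple joins′ joins) (Equivalence.from (isP e) (here ≡.refl))))
    2≤ (_ ◅ _ ◅ p) _ _ = s≤s (s≤s z≤n)
    to : ∀ d → d ∈ P ∪ ⁅ f ⁆ → d ∈ˡ f ∷ edges G p
    to d d∈ with x∈p∪q⁻ P ⁅ f ⁆ d∈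
    ... | inj₁ d∈P = there (Equivalence.to (isP d) d∈P)
    ... | inj₂ d∈f = here (x∈⁅y⁆⇒x≡y f d∈f)
    from : ∀ d → d ∈ˡ f ∷ edges G p → d ∈ P ∪ ⁅ f ⁆
    from d (here ≡.refl) = x∈p∪q⁺ {p = P} (inj₂ (x∈⁅x⁆ f))
    from d (there d∈)    = x∈p∪q⁺ (inj₁ (Equivalence.from (isP d) d∈))

  -- Connected sets of nodes

  module _ (E : Subset m) where

    -- Adjacency in the subgraph of (V, E) induced on `A`: blocks have to be connected without the
    -- lifted edges.
    Link : List (Fin n) → Fin n → Fin n → Set
    Link A u v = Step G E u v × u ∈ˡ A × v ∈ˡ A

    ConnectedIn : List (Fin n) → Set
    ConnectedIn A = ∀ {u v} → u ∈ˡ A → v ∈ˡ A → Star (Link A) u v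

    link-mono : ∀ {A B u v} → (∀ {x} → x ∈ˡ A → x ∈ˡ B) → Star (Link A) u v → Star (Link B) u v
    link-mono A⊆B = Star.map λ (s , u∈A , v∈A) → s , A⊆B u∈A , A⊆B v∈A

    link-sym : ∀ {A u v} → Star (Link A) u v → Star (Link A) v u
    link-sym = Star.reverse λ (s , u∈A , v∈A) → step-sym s , v∈A , u∈A

    connected-cong : ∀ {A B} → (∀ {x} → x ∈ˡ A → x ∈ˡ B) → (∀ {x} → x ∈ˡ B → x ∈ˡ A) → ConnectedIn A → ConnectedIn B
    connected-cong A⊆B B⊆A conn u∈B v∈B = link-mono A⊆B (conn (B⊆A u∈B) (B⊆A v∈B))

    connected-[] : ConnectedIn []
    connected-[] ()

    connected-[_] : ∀ a → ConnectedIn (a ∷ [])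
    connected-[ a ] (here ≡.refl) (here ≡.refl) = ε

    connected-∷ : ∀ {A a u} → Step G E a u → u ∈ˡ A → ConnectedIn A → ConnectedIn (a ∷ A)
    connected-∷ {A} {a} {u} s u∈A conn x∈ y∈ = toU x∈ ◅◅ link-sym (toU y∈)
      where
      toU : ∀ {x} → x ∈ˡ a ∷ A → Star (Link (a ∷ A)) x u
      toU (here ≡.refl) = (s , here ≡.refl , there u∈A) ◅ ε
      toU (there x∈A)   = link-mono there (conn x∈A u∈A)

    connected-nodes : ∀ {u v} (p : Walk G E u v) → ConnectedIn (nodes G p)
    connected-nodes {u} ε   = connected-[ u ]
    connected-nodes (s ◅ p) = connected-∷ s (here ≡.refl) (connected-nodes p)

    connected-++ : ∀ {b u j B} (p : Walk G E b u) → Step G E u j → j ∈ˡ B → ConnectedIn B → ConnectedIn (nodes G p ++ B)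
    connected-++ ε       t j∈B conn = connected-∷ t j∈B conn
    connected-++ (s ◅ p) t j∈B conn = connected-∷ s (here ≡.refl) (connected-++ p t j∈B conn)

    -- A path of (V, E) from `b` to its first node `end` in `W`. `b` is kept apart from `interior`
    -- because blocks are compared with and without `b`: `attach` joins the interior to a block, and
    -- `first` then adds `b`.
    record Tail (W : List (Fin n)) (b : Fin n) : Set where
      field
        {end}    : Fin n
        end∈W    : end ∈ˡ W
        interior : List (Fin n)
        b∉       : b ∉ˡ interior
        avoids   : ∀ {x} → x ∈ˡ interior → x ∉ˡ W
        conn     : ConnectedIn interior
        attach   : ∀ {B} → end ∈ˡ B → ConnectedIn B → ConnectedIn (interior ++ B)
        {next}   : Fin n
        first    : Step G E b next
        next∈    : next ∈ˡ interior ⊎ (next ≡ end × interior ≡ [])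

      next∈++ : ∀ {B} → end ∈ˡ B → next ∈ˡ interior ++ B
      next∈++ end∈B with next∈
      ... | inj₁ next∈i       = ∈-++⁺ˡ next∈i
      ... | inj₂ (eq , _) = ∈-++⁺ʳ interior (≡.subst (_∈ˡ _) (≡.sym eq) end∈B)

      conn-b∷ : ConnectedIn (b ∷ interior)
      conn-b∷ with next∈
      ... | inj₁ next∈i       = connected-∷ first next∈i conn
      ... | inj₂ (_ , eq)   = ≡.subst (λ i → ConnectedIn (b ∷ i)) (≡.sym eq) connected-[ b ]

      attach-b∷ : ∀ {B} → end ∈ˡ B → ConnectedIn B → ConnectedIn (b ∷ interior ++ B)
      attach-b∷ end∈B connB = connected-∷ first (next∈++ end∈B) (attach end∈B connB)

    private
      record Approach (W : List (Fin n)) (b : Fin n) : Set where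
        field
          {u j}  : Fin n
          walk   : Walk G E b u
          uniq   : Unique (nodes G walk)
          avoids : ∀ {x} → x ∈ˡ nodes G walk → x ∉ˡ W
          last   : Step G E u j
          j∈W    : j ∈ˡ W

      approach : ∀ {W b v} → Walk G E b v → v ∈ˡ W → b ∈ˡ W ⊎ Approach W b
      approach ε v∈W = inj₁ v∈W
      approach {W} {b} (s ◅ p) v∈W with b ∈ˡ? W
      ... | yes b∈W = inj₁ b∈W
      ... | no b∉W with approach p v∈W
      ...   | inj₁ j∈W = inj₂ (record
        { walk = ε ; uniq = [] ∷ [] ; avoids = λ { (here ≡.refl) → b∉W } ; last = s ; j∈W = j∈W })
      ...   | inj₂ a = inj₂ (record
        { walk = proj₁ path ; uniq = proj₁ (proj₂ path)
        ; avoids = λ x∈ → avoids′ (proj₂ (proj₂ path) x∈) ; last = last ; j∈W = j∈W })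
        where
        open Approach a
        -- Prepending `b` may close a loop; erasing it introduces no node, so `W` is still avoided.
        path = toPath (s ◅ walk)
        avoids′ : ∀ {x} → x ∈ˡ nodes G (s ◅ walk) → x ∉ˡ W
        avoids′ (here ≡.refl) = b∉W
        avoids′ (there x∈)    = avoids x∈

    tail : ∀ {W b v} → Walk G E b v → v ∈ˡ W → b ∉ˡ W → Tail W b
    tail {W} {b} p v∈W b∉W with approach p v∈W
    ... | inj₁ b∈W = ⊥-elim (b∉W b∈W)
    ... | inj₂ record { walk = ε ; uniq = uniq ; avoids = avoids ; last = s ; j∈W = j∈W } = record
      { end∈W = j∈W ; interior = [] ; b∉ = λ () ; avoids = λ () ; conn = connected-[] ; attach = λ _ conn → conn
      ; first = s ; next∈ = inj₂ (≡.refl , ≡.refl) }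
    ... | inj₂ record { walk = s ◅ q ; uniq = uniq ; avoids = avoids ; last = t ; j∈W = j∈W } = record
      { end∈W = j∈W ; interior = nodes G q ; b∉ = unique-head uniq ; avoids = λ x∈ → avoids (there x∈)
      ; conn = connected-nodes q ; attach = connected-++ q t ; first = s ; next∈ = inj₁ (here ≡.refl) }

  -- Decompositions into two blocks and singletons

  Disjoint : List (Fin n) → List (Fin n) → Set
  Disjoint A B = ∀ {u} → u ∈ˡ A → u ∉ˡ B

  -- A node outside both blocks is not even `Together` with itself. Edges have distinct ends, so the
  -- uncut edges are exactly those with `Together` ends.
  Together : List (Fin n) → List (Fin n) → Fin n → Fin n → Set
  Together A B u v = (u ∈ˡ A × v ∈ˡ A) ⊎ (u ∈ˡ B × v ∈ˡ B)

  together? : ∀ A B u v → Dec (Together A B u v)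
  together? A B u v = (u ∈ˡ? A ×-dec v ∈ˡ? A) ⊎-dec (u ∈ˡ? B ×-dec v ∈ˡ? B)

  together-sym : ∀ {A B u v} → Together A B u v → Together A B v u
  together-sym (inj₁ (u∈ , v∈)) = inj₁ (v∈ , u∈)
  together-sym (inj₂ (u∈ , v∈)) = inj₂ (v∈ , u∈)

  together-trans : ∀ {A B} → Disjoint A B → ∀ {u v w} → Together A B u v → Together A B v w → Together A B u w
  together-trans A∩B (inj₁ (u∈A , _))   (inj₁ (_ , w∈A))   = inj₁ (u∈A , w∈A)
  together-trans A∩B (inj₂ (u∈B , _))   (inj₂ (_ , w∈B))   = inj₂ (u∈B , w∈B)
  together-trans A∩B (inj₁ (_ , v∈A))   (inj₂ (v∈B , _))   = contradiction v∈B (A∩B v∈A)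
  together-trans A∩B (inj₂ (_ , v∈B))   (inj₁ (v∈A , _))   = contradiction v∈B (A∩B v∈A)

  module _ {A B : List (Fin n)} where

    together-src-tgt : ∀ {g u v} → Joins g u v → Together A B u v → Together A B (src g) (tgt g)
    together-src-tgt (inj₁ (≡.refl , ≡.refl)) t = t
    together-src-tgt (inj₂ (≡.refl , ≡.refl)) t = together-sym t

    src-tgt-together : ∀ {g u v} → Joins g u v → Together A B (src g) (tgt g) → Together A B u v
    src-tgt-together (inj₁ (≡.refl , ≡.refl)) t = t
    src-tgt-together (inj₂ (≡.refl , ≡.refl)) t = together-sym t


  bit : Bool → ℤ
  bit b = if b then + 1 else + 0

  ptℤ : List (Fin n) → List (Fin n) → Fin m → ℤ
  ptℤ A B g = if does (together? A B (src g) (tgt g)) then + 0 else + 1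

  ptℤ≡0 : ∀ {A B g u v} → Joins g u v → Together A B u v → ptℤ A B g ≡ + 0
  ptℤ≡0 {A} {B} {g} joins t rewrite dec-true (together? A B (src g) (tgt g)) (together-src-tgt joins t) = ≡.refl

  ptℤ≡1 : ∀ {A B g u v} → Joins g u v → ¬ Together A B u v → ptℤ A B g ≡ + 1
  ptℤ≡1 {A} {B} {g} joins ¬t rewrite dec-false (together? A B (src g) (tgt g)) (¬t ∘ src-tgt-together joins) = ≡.refl

  inside : List (Fin n) → Fin m → ℤ
  inside A g = bit (does (src g ∈ˡ? A) ∧ does (tgt g ∈ˡ? A))

  between : Fin n → List (Fin n) → Fin m → ℤ
  between b M g = bit (does (src g ≟ b) ∧ does (tgt g ∈ˡ? M)) ℤ.+ bit (does (src g ∈ˡ? M) ∧ does (tgt g ≟ b))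

  -- The unit vector of the edge ab if there is one and zero otherwise, so pairs can be combined
  -- without asking whether they are adjacent.
  pair : Fin n → Fin n → Fin m → ℤ
  pair a b g = bit (does (src g ≟ a) ∧ does (tgt g ≟ b)) ℤ.+ bit (does (src g ≟ b) ∧ does (tgt g ≟ a))

  -- Disjoint blocks never count an edge twice. The point becomes additive in its blocks, so
  -- changing one block is a difference of `inside` vectors.
  ptℤ-inside : ∀ {A B} → Disjoint A B → ∀ g → ptℤ A B g ≡ + 1 ℤ.- inside A g ℤ.- inside B g
  ptℤ-inside {A} {B} A∩B g with src g ∈ˡ? A | tgt g ∈ˡ? A | src g ∈ˡ? B | tgt g ∈ˡ? B
  ... | yes s∈A | _       | yes s∈B | _       = contradiction s∈B (A∩B s∈A)
  ... | _       | yes t∈A | _       | yes t∈B = contradiction t∈B (A∩B t∈A)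
  ... | yes _   | yes _   | no _    | no _    = ≡.refl
  ... | yes _   | no _    | no _    | yes _   = ≡.refl
  ... | yes _   | no _    | no _    | no _    = ≡.refl
  ... | no _    | yes _   | yes _   | no _    = ≡.refl
  ... | no _    | yes _   | no _    | no _    = ≡.refl
  ... | no _    | no _    | yes _   | yes _   = ≡.refl
  ... | no _    | no _    | yes _   | no _    = ≡.refl
  ... | no _    | no _    | no _    | yes _   = ≡.refl
  ... | no _    | no _    | no _    | no _    = ≡.refl

  inside-∷ : ∀ {b M} → b ∉ˡ M → ∀ g → inside (b ∷ M) g ≡ between b M g ℤ.+ inside M g
  inside-∷ {b} {M} b∉M g with src g ≟ b | tgt g ≟ b | src g ∈ˡ? M | tgt g ∈ˡ? M
  ... | yes s≡b | yes t≡b | _       | _       = contradiction (≡.trans s≡b (≡.sym t≡b)) (loopless g)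
  ... | yes s≡b | no _    | yes s∈M | _       = contradiction (≡.subst (_∈ˡ M) s≡b s∈M) b∉M
  ... | no _    | yes t≡b | _       | yes t∈M = contradiction (≡.subst (_∈ˡ M) t≡b t∈M) b∉M
  ... | yes _   | no _    | no _    | yes _   = ≡.refl
  ... | yes _   | no _    | no _    | no _    = ≡.refl
  ... | no _    | yes _   | yes _   | no _    = ≡.refl
  ... | no _    | yes _   | no _    | no _    = ≡.refl
  ... | no _    | no _    | yes _   | yes _   = ≡.refl
  ... | no _    | no _    | yes _   | no _    = ≡.refl
  ... | no _    | no _    | no _    | yes _   = ≡.refl
  ... | no _    | no _    | no _    | no _    = ≡.refl

  between-∷ : ∀ {a b M} → b ∉ˡ M → ∀ g → between a (b ∷ M) g ≡ pair a b g ℤ.+ between a M g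
  between-∷ {a} {b} {M} b∉M g = ≡.trans
    (≡.cong₂ ℤ._+_ (onTgt (does (src g ≟ a))) (onSrc (does (tgt g ≟ a))))
    (interchange (bit (does (src g ≟ a) ∧ does (tgt g ≟ b))) _ _ _)
    where
    onTgt : ∀ x → bit (x ∧ does (tgt g ∈ˡ? (b ∷ M))) ≡ bit (x ∧ does (tgt g ≟ b)) ℤ.+ bit (x ∧ does (tgt g ∈ˡ? M))
    onTgt false = ≡.refl
    onTgt true with tgt g ≟ b | tgt g ∈ˡ? M
    ... | yes t≡b | yes t∈M = contradiction (≡.subst (_∈ˡ M) t≡b t∈M) b∉M
    ... | yes _   | no _    = ≡.refl
    ... | no _    | yes _   = ≡.refl
    ... | no _    | no _    = ≡.refl
    onSrc : ∀ x → bit (does (src g ∈ˡ? (b ∷ M)) ∧ x) ≡ bit (does (src g ≟ b) ∧ x) ℤ.+ bit (does (src g ∈ˡ? M) ∧ x)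
    onSrc x with src g ≟ b | src g ∈ˡ? M
    ... | yes s≡b | yes s∈M = contradiction (≡.subst (_∈ˡ M) s≡b s∈M) b∉M
    ... | yes _   | no _    = ≡.sym (ℤ.+-identityʳ _)
    ... | no _    | yes _   = ≡.sym (ℤ.+-identityˡ _)
    ... | no _    | no _    = ≡.refl
    interchange : ∀ x y z t → (x ℤ.+ y) ℤ.+ (z ℤ.+ t) ≡ (x ℤ.+ z) ℤ.+ (y ℤ.+ t)
    interchange = solve-∀

  member-cong : ∀ {A B : List (Fin n)} → (∀ {x} → x ∈ˡ A → x ∈ˡ B) → (∀ {x} → x ∈ˡ B → x ∈ˡ A) →
                ∀ x → does (x ∈ˡ? A) ≡ does (x ∈ˡ? B)
  member-cong {A} {B} A⊆B B⊆A x with x ∈ˡ? A | x ∈ˡ? B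
  ... | yes _   | yes _   = ≡.refl
  ... | yes x∈A | no x∉B  = contradiction (A⊆B x∈A) x∉B
  ... | no x∉A  | yes x∈B = contradiction (B⊆A x∈B) x∉A
  ... | no _    | no _    = ≡.refl

  between-cong : ∀ {b A B} → (∀ {x} → x ∈ˡ A → x ∈ˡ B) → (∀ {x} → x ∈ˡ B → x ∈ˡ A) →
                 ∀ g → between b A g ≡ between b B g
  between-cong {b} A⊆B B⊆A g = ≡.cong₂ (λ x y → bit (does (src g ≟ b) ∧ x) ℤ.+ bit (y ∧ does (tgt g ≟ b)))
    (member-cong A⊆B B⊆A (tgt g)) (member-cong A⊆B B⊆A (src g))

  pair-sym : ∀ a b g → pair a b g ≡ pair b a g
  pair-sym a b g = ℤ.+-comm (bit (does (src g ≟ a) ∧ does (tgt g ≟ b))) _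

  pair-joins : ∀ {e a b} → Joins e a b → ∀ g → pair a b g ≡ bit (does (e ≟ g))
  pair-joins {e} {a} {b} joins g with e ≟ g
  pair-joins {e} {a} {b} joins g | no e≢g with src g ≟ a | tgt g ≟ b | src g ≟ b | tgt g ≟ a
  ... | yes s≡a | yes t≡b | _       | _       = contradiction (simple joins (inj₁ (s≡a , t≡b))) e≢g
  ... | _       | _       | yes s≡b | yes t≡a = contradiction (simple joins (inj₂ (s≡b , t≡a))) e≢g
  ... | yes _   | no _    | yes _   | no _    = ≡.refl
  ... | yes _   | no _    | no _    | _       = ≡.refl
  ... | no _    | _       | yes _   | no _    = ≡.refl
  ... | no _    | _       | no _    | _       = ≡.refl
  pair-joins {e} {a} {b} joins g | yes ≡.refl with src g ≟ a | tgt g ≟ b | src g ≟ b | tgt g ≟ a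
  ... | yes ≡.refl | _          | yes ≡.refl | _          = contradiction joins joins-irrefl
  ... | yes _      | yes _      | no _       | _          = ≡.refl
  ... | no _       | _          | yes _      | yes _      = ≡.refl
  ... | no s≢a     | _          | no s≢b     | _          = case joins of λ
    { (inj₁ (s≡a , _)) → contradiction s≡a s≢a ; (inj₂ (s≡b , _)) → contradiction s≡b s≢b }
  ... | yes ≡.refl | no t≢b     | no s≢b     | _          = case joins of λ
    { (inj₁ (_ , t≡b)) → contradiction t≡b t≢b ; (inj₂ (s≡b , _)) → contradiction s≡b s≢b }
  ... | no s≢a     | _          | yes _      | no t≢a     = case joins of λ
    { (inj₁ (s≡a , _)) → contradiction s≡a s≢a ; (inj₂ (_ , t≡a)) → contradiction t≡a t≢a }

-- Feasible points

module Points {c ℓ₁ ℓ₂ : Level} (K : OrderedField c ℓ₁ ℓ₂) {n m : ℕ} (G′ : Graph n m) (E : Subset m) where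
  open OrderedField K using (_≤_; +-monoʳ-≤; 0≉1)
  open Scalars K
  open Polyhedral K
  open LiftedMulticut K G′ E
  open Graph G′
  open Walks G′
  open SetoidReasoning setoid

  sumL : List (Fin m) → Vector Carrier m → Carrier
  sumL []      x = 0#
  sumL (e ∷ L) x = x e + sumL L x

  sumL-++ : ∀ L M x → sumL (L ++ M) x ≈ sumL L x + sumL M x
  sumL-++ []      M x = sym (+-identityˡ _)
  sumL-++ (e ∷ L) M x = trans (+-congˡ (sumL-++ L M x)) (sym (+-assoc _ _ _))

  sumL-≈0 : ∀ L x → (∀ {e} → e ∈ˡ L → x e ≈ 0#) → sumL L x ≈ 0#
  sumL-≈0 []      x x≈0 = refl
  sumL-≈0 (e ∷ L) x x≈0 = trans (+-cong (x≈0 (here ≡.refl)) (sumL-≈0 L x (x≈0 ∘ there))) (+-identityˡ 0#)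

  δ : Fin m → Vector Carrier m
  δ e j = if does (e ≟ j) then 1# else 0#

  δ-∙ : ∀ e x → δ e ∙ x ≈ x e
  δ-∙ e x = trans (sum-single (λ j → δ e j * x j) e off) on
    where
    off : ∀ j → e ≢ j → δ e j * x j ≈ 0#
    off j e≢j with e ≟ j
    ... | yes e≡j = contradiction e≡j e≢j
    ... | no _    = zeroˡ (x j)
    on : δ e e * x e ≈ x e
    on with e ≟ e
    ... | yes _  = *-identityˡ (x e)
    ... | no e≢e = contradiction ≡.refl e≢e

  indicator : List (Fin m) → Vector Carrier m
  indicator []      j = 0#
  indicator (e ∷ L) j = δ e j + indicator L j

  ∙-+ : ∀ (a b x : Vector Carrier m) → (λ j → a j + b j) ∙ x ≈ a ∙ x + b ∙ x
  ∙-+ a b x = trans (sum-cong-≋ (λ j → distribʳ (x j) (a j) (b j))) (∑-distrib-+ (λ j → a j * x j) (λ j → b j * x j))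

  ∙-scale : ∀ k (a x : Vector Carrier m) → (λ j → k * a j) ∙ x ≈ k * (a ∙ x)
  ∙-scale k a x = ∑-scale k a x

  indicator-∙ : ∀ L x → indicator L ∙ x ≈ sumL L x
  indicator-∙ []      x = sum-≈0 (λ j → 0# * x j) (λ j → zeroˡ (x j))
  indicator-∙ (e ∷ L) x = trans (∙-+ (δ e) (indicator L) x) (+-cong (δ-∙ e x) (indicator-∙ L x))

  -- Coefficients of the functional x f - ∑ x over `L`. It has no constant term, so tight points lie
  -- on a hyperplane through the origin.
  gap : Fin m → List (Fin m) → Vector Carrier m
  gap f L j = δ f j + - 1# * indicator L j

  gap-∙ : ∀ f L x → gap f L ∙ x ≈ x f - sumL L x
  gap-∙ f L x = begin
    gap f L ∙ x                                      ≈⟨ ∙-+ (δ f) (λ j → - 1# * indicator L j) x ⟩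
    δ f ∙ x + (λ j → - 1# * indicator L j) ∙ x       ≈⟨ +-cong (δ-∙ f x) (∙-scale (- 1#) (indicator L) x) ⟩
    x f + - 1# * (indicator L ∙ x)                   ≈⟨ +-congˡ (*-congˡ (indicator-∙ L x)) ⟩
    x f + - 1# * sumL L x                            ≈⟨ solve 2 (λ a b → a :+ :- con (+ 1) :* b := a :- b) refl (x f) _ ⟩
    x f - sumL L x                                   ∎

  gap≈0⇒ : ∀ {f L x} → gap f L ∙ x ≈ 0# → x f ≈ sumL L x
  gap≈0⇒ {f} {L} {x} eq = begin
    x f                              ≈⟨ solve 2 (λ a b → a := (a :- b) :+ b) refl (x f) (sumL L x) ⟩
    x f - sumL L x + sumL L x        ≈⟨ +-congʳ (trans (sym (gap-∙ f L x)) eq) ⟩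
    0# + sumL L x                    ≈⟨ +-identityˡ _ ⟩
    sumL L x                         ∎

  ⇒gap≈0 : ∀ {f L x} → x f ≈ sumL L x → gap f L ∙ x ≈ 0#
  ⇒gap≈0 {f} {L} {x} eq = trans (gap-∙ f L x) (trans (+-congʳ eq) (-‿inverseʳ _))

  sumOver≈sumL : ∀ {S L} x → Unique L → (∀ e → (e ∈ S) ⇔ (e ∈ˡ L)) → sumOver S x ≈ sumL L x
  sumOver≈sumL {S} {L} x uniq S⇔L = trans (sum-cong-≋ pointwise) (sumMember L uniq)
    where
    memb : List (Fin m) → Vector Carrier m
    memb L e = if does (e ∈ˡ? L) then x e else 0#
    pointwise : ∀ e → (if lookup S e then x e else 0#) ≈ memb L e
    pointwise e with e ∈ˡ? L
    ... | yes e∈L = reflexive (≡.cong (if_then x e else 0#) ([]=⇒lookup (Equivalence.from (S⇔L e) e∈L)))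
    ... | no e∉L with lookup S e in eq
    ...   | false = refl
    ...   | true  = contradiction (Equivalence.to (S⇔L e) (lookup⇒[]= e S eq)) e∉L
    sumMember : ∀ L → Unique L → sum (memb L) ≈ sumL L x
    sumMember [] _ = sum-≈0 (memb []) (λ _ → refl)
    sumMember (d ∷ L) uniq@(_ ∷ uniq′) = begin
      sum (memb (d ∷ L))                          ≈⟨ sum-cong-≋ step ⟩
      sum (λ e → δ d e * x e + memb L e)          ≈⟨ ∑-distrib-+ (λ e → δ d e * x e) (memb L) ⟩
      δ d ∙ x + sum (memb L)                      ≈⟨ +-cong (δ-∙ d x) (sumMember L uniq′) ⟩
      x d + sumL L x                              ∎
      where
      step : ∀ e → memb (d ∷ L) e ≈ δ d e * x e + memb L e
      step e with d ≟ e | e ≟ d | e ∈ˡ? L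
      ... | yes ≡.refl | _          | yes d∈L = contradiction d∈L (unique-head uniq)
      ... | yes ≡.refl | yes _      | no _    = sym (trans (+-identityʳ _) (*-identityˡ (x e)))
      ... | yes ≡.refl | no e≢e     | no _    = contradiction ≡.refl e≢e
      ... | no d≢e     | yes ≡.refl | _       = contradiction ≡.refl d≢e
      ... | no _       | no _       | yes _   = sym (trans (+-congʳ (zeroˡ (x e))) (+-identityˡ _))
      ... | no _       | no _       | no _    = sym (trans (+-congʳ (zeroˡ (x e))) (+-identityˡ _))

  Binary : Vector Carrier m → Set _
  Binary x = ∀ e → x e ≈ 0# ⊎ x e ≈ 1#

  module _ {x : Vector Carrier m} (bin : Binary x) where

    binary-0≤ : ∀ e → 0# ≤ x e
    binary-0≤ e with bin e
    ... | inj₁ x≈0 = ≤-reflexive (sym x≈0)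
    ... | inj₂ x≈1 = ≤-respʳ-≈ (sym x≈1) 0≤1

    binary-≤1 : ∀ e → x e ≤ 1#
    binary-≤1 e with bin e
    ... | inj₁ x≈0 = ≤-respˡ-≈ (sym x≈0) 0≤1
    ... | inj₂ x≈1 = ≤-reflexive x≈1

    0≤sumL : ∀ L → 0# ≤ sumL L x
    0≤sumL []      = ≤-refl
    0≤sumL (e ∷ L) = ≤-respˡ-≈ (+-identityˡ 0#) (+-mono-≤ (binary-0≤ e) (0≤sumL L))

    -- Integrality of 0/1 sums as a dichotomy, with the choice read off from `bin`.
    allZero⊎1≤sumL : ∀ L → (∀ {e} → e ∈ˡ L → x e ≈ 0#) ⊎ 1# ≤ sumL L x
    allZero⊎1≤sumL [] = inj₁ λ ()
    allZero⊎1≤sumL (e ∷ L) with bin e | allZero⊎1≤sumL L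
    ... | inj₁ x≈0 | inj₁ zeros = inj₁ λ { (here ≡.refl) → x≈0 ; (there e∈L) → zeros e∈L }
    ... | inj₁ x≈0 | inj₂ 1≤    = inj₂ (≤-respˡ-≈ (+-identityˡ 1#) (+-mono-≤ (binary-0≤ e) 1≤))
    ... | inj₂ x≈1 | _          = inj₂ (≤-respˡ-≈ (+-identityʳ 1#) (+-mono-≤ (≤-reflexive (sym x≈1)) (0≤sumL L)))

    binary-integral : ∀ e → ∃[ z ] x e ≈ ι z
    binary-integral e with bin e
    ... | inj₁ x≈0 = + 0 , x≈0
    ... | inj₂ x≈1 = + 1 , x≈1

    sumL-integral : ∀ L → ∃[ z ] sumL L x ≈ ι z
    sumL-integral [] = + 0 , refl
    sumL-integral (e ∷ L) with binary-integral e | sumL-integral L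
    ... | y , x≈y | z , s≈z = y ℤ.+ z , trans (+-cong x≈y s≈z) (sym (ι-+ y z))

    -- Both sides are images of integers, which are compared in ℤ.
    gap-dec : ∀ f L → Dec (gap f L ∙ x ≈ 0#)
    gap-dec f L with binary-integral f | sumL-integral L
    ... | y , x≈y | z , s≈z with y ℤ.≟ z
    ...   | yes ≡.refl = yes (⇒gap≈0 {f} {L} (trans x≈y (sym s≈z)))
    ...   | no y≢z     = no λ eq → y≢z (ι-injective (trans (sym x≈y) (trans (gap≈0⇒ {f} {L} eq) s≈z)))

  ∪∖ : ∀ {P : Subset m} {f} → f ∉ P → (P ∪ ⁅ f ⁆) ∖ f ≡ P
  ∪∖ {P} {f} f∉P = ⊆-antisym to from
    where
    to : (P ∪ ⁅ f ⁆) ∖ f ⊆ P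
    to e∈ with x∈p∪q⁻ P ⁅ f ⁆ (p─q⊆p (P ∪ ⁅ f ⁆) ⁅ f ⁆ e∈)
    ... | inj₁ e∈P = e∈P
    ... | inj₂ e∈f with x∈⁅y⁆⇒x≡y f e∈f
    ...   | ≡.refl = contradiction e∈ (x∉p∖x (P ∪ ⁅ f ⁆) f)
    from : P ⊆ (P ∪ ⁅ f ⁆) ∖ f
    from e∈P = x∈p∧x≢y⇒x∈p-y (x∈p∪q⁺ (inj₁ e∈P)) λ { ≡.refl → f∉P e∈P }

  ∖∪ : ∀ {C : Subset m} {e} → e ∈ C → (C ∖ e) ∪ ⁅ e ⁆ ≡ C
  ∖∪ {C} {e} e∈C = ⊆-antisym to from
    where
    to : (C ∖ e) ∪ ⁅ e ⁆ ⊆ C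
    to d∈ with x∈p∪q⁻ (C ∖ e) ⁅ e ⁆ d∈
    ... | inj₁ d∈C = p─q⊆p C ⁅ e ⁆ d∈C
    ... | inj₂ d∈e with x∈⁅y⁆⇒x≡y e d∈e
    ...   | ≡.refl = e∈C
    from : C ⊆ (C ∖ e) ∪ ⁅ e ⁆
    from {d} d∈C with d ≟ e
    ... | yes ≡.refl = x∈p∪q⁺ {p = C ∖ e} (inj₂ (x∈⁅x⁆ e))
    ... | no d≢e     = x∈p∪q⁺ (inj₁ (x∈p∧x≢y⇒x∈p-y d∈C d≢e))

  -- Feasible points and their uncut edges

  module Feasible {x : Vector Carrier m} (Xx : X x) where
    open X Xx

    -- Conditions (i) and (ii) in one form: for a lifted `f` this is the path condition, and an `f`
    -- in `E` closes the path to a cycle.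
    path-≤ : ∀ {f v w} (p : Walk G′ E v w) → Unique (nodes G′ p) → Joins f v w → f ∉ˡ edges G′ p →
             x f ≤ sumL (edges G′ p) x
    path-≤ {f} {v} {w} p uniq joins f∉p = ≤-respʳ-≈ (sumOver≈sumL x (unique-edges p uniq) isP) x≤
      where
      P = fromList (edges G′ p)
      isP = ∈-fromList (edges G′ p)
      f∉P : f ∉ P
      f∉P = f∉p ∘ Equivalence.to (isP f)
      x≤ : x f ≤ sumOver P x
      x≤ with f ∈? E
      ... | no f∉E  = path f v w f∉E joins P (p , uniq , isP)
      ... | yes f∈E = ≡.subst (λ P → x f ≤ sumOver P x) (∪∖ f∉P)
        (cycle (P ∪ ⁅ f ⁆) (path⇒cycle (p , uniq , isP) joins f∈E f∉P) f (x∈p∪q⁺ {p = P} (inj₂ (x∈⁅x⁆ f))))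

    isZero : Fin m → Bool
    isZero e = [ (λ _ → true) , (λ _ → false) ]′ (binary e)

    isZero⇒ : ∀ {e} → isZero e ≡ true → x e ≈ 0#
    isZero⇒ {e} _ with binary e
    ... | inj₁ x≈0 = x≈0

    ⇒isZero : ∀ {e} → x e ≈ 0# → isZero e ≡ true
    ⇒isZero {e} x≈0 with binary e
    ... | inj₁ _   = ≡.refl
    ... | inj₂ x≈1 = contradiction (trans (sym x≈0) x≈1) 0≉1

    zeros : Subset m
    zeros = tabulate (λ e → does (e ∈? E) ∧ isZero e)

    ∈zeros⁺ : ∀ {e} → e ∈ E → x e ≈ 0# → e ∈ zeros
    ∈zeros⁺ {e} e∈E x≈0 = ∈-tabulate⁺ (≡.cong₂ _∧_ (dec-true (e ∈? E) e∈E) (⇒isZero x≈0))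

    ∈zeros⁻ : ∀ {e} → e ∈ zeros → e ∈ E × x e ≈ 0#
    ∈zeros⁻ {e} e∈ with e ∈? E | ∈-tabulate⁻ {p = λ e → does (e ∈? E) ∧ isZero e} e∈
    ... | yes e∈E | eq = e∈E , isZero⇒ eq

    -- After loop erasure either `f` lies on the path, or the path bounds `x f` by zero.
    zeroWalk⇒≈0 : ∀ {f v w} → Walk G′ zeros v w → Joins f v w → x f ≈ 0#
    zeroWalk⇒≈0 {f} walk joins with toPath walk
    ... | p , uniq , _ with f ∈ˡ? edges G′ p
    ...   | yes f∈p = proj₂ (∈zeros⁻ (edges⊆ p f∈p))
    ...   | no f∉p  = antisym (≤-respʳ-≈ (sumL-≈0 _ x λ e∈ → proj₂ (∈zeros⁻ (edges⊆ p (≡.subst (_ ∈ˡ_) (edges-weaken z⊆E p) e∈))))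
      (path-≤ (weaken z⊆E p) (≡.subst (λ L → Unique (_ ∷ L)) (≡.sym (laterNodes-weaken z⊆E p)) uniq) joins
        (f∉p ∘ ≡.subst (f ∈ˡ_) (edges-weaken z⊆E p))))
      (binary-0≤ binary f)
      where
      z⊆E : zeros ⊆ E
      z⊆E = proj₁ ∘ ∈zeros⁻

    -- For a lifted `g` without such a walk, `E ─ zeros` separates its ends. A minimal separator
    -- inside it is a cut of edges with value 1, whose inequality reads 1 ≤ 0. Reachability is not
    -- decided, hence the double negation.
    ≈0⇒¬¬zeroWalk : ∀ {g v w} → Joins g v w → x g ≈ 0# → ¬ ¬ Walk G′ zeros v w
    ≈0⇒¬¬zeroWalk {g} {v} {w} joins xg≈0 ¬walk with g ∈? E
    ... | yes g∈E = ¬walk ((g , ∈zeros⁺ g∈E xg≈0 , joins) ◅ ε)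
    ... | no g∉E  = noSeparator (E ─ zeros) (⊂-wellFounded _) ⊆-refl separates
      where
      separates : Separates G′ E v w (E ─ zeros)
      separates = p─q⊆p E zeros , λ walk → ¬walk (weaken back walk)
        where
        back : E ─ (E ─ zeros) ⊆ zeros
        back {e} e∈ with e ∈? zeros
        ... | yes e∈z = e∈z
        ... | no e∉z  = contradiction (x∈p∧x∉q⇒x∈p─q (p─q⊆p E _ e∈) e∉z) (x∈p─q⇒x∉q E (E ─ zeros) e∈)
      noCut : ∀ D → D ⊆ E ─ zeros → ¬ IsCut G′ E v w D
      noCut D D⊆ isCut = 1≰0 (≤-respˡ-≈ 1-xg≈1 (≤-respʳ-≈ sum≈0 (cut g v w g∉E joins D isCut)))
        where
        1-xg≈1 : 1# - x g ≈ 1#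
        1-xg≈1 = trans (+-congˡ (-‿cong xg≈0)) (solve 0 (con (+ 1) :- con (+ 0) := con (+ 1)) refl)
        sum≈0 : sumOver D (λ e → 1# - x e) ≈ 0#
        sum≈0 = sum-≈0 _ term≈0
          where
          term≈0 : ∀ e → (if lookup D e then 1# - x e else 0#) ≈ 0#
          term≈0 e with lookup D e in eq
          ... | false = refl
          ... | true with D⊆ (lookup⇒[]= e D eq) | binary e
          ...   | _  | inj₂ xe≈1 = trans (+-congˡ (-‿cong xe≈1)) (-‿inverseʳ 1#)
          ...   | e∈ | inj₁ xe≈0 = contradiction (∈zeros⁺ (p─q⊆p E zeros e∈) xe≈0) (x∈p─q⇒x∉q E zeros e∈)
      noSeparator : ∀ D → Acc _⊂_ D → D ⊆ E ─ zeros → ¬ Separates G′ E v w D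
      -- By induction no proper subset of `D` separates, so `D` would be a minimal separator, that
      -- is, a cut.
      noSeparator D (acc smaller) D⊆ sep = noCut D D⊆ (sep , minimal)
        where
        minimal : ∀ D′ → D′ ⊆ D → Separates G′ E v w D′ → D′ ≡ D
        minimal D′ D′⊆D sep′ with ≡-dec _≟ᵇ_ D′ D
        ... | yes D′≡D = D′≡D
        ... | no D′≢D  = ⊥-elim (noSeparator D′ (smaller (⊆∧≢⇒⊂ D′⊆D D′≢D)) (⊆-trans D′⊆D D⊆) sep′)

  -- The multicut of the decomposition with blocks A, B and singletons.
  pt : List (Fin n) → List (Fin n) → Vector Carrier m
  pt A B g = if does (together? A B (src g) (tgt g)) then 0# else 1#

  module _ {A B : List (Fin n)} where

    pt≡0 : ∀ {g u v} → Joins g u v → Together A B u v → pt A B g ≡ 0#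
    pt≡0 {g} joins t rewrite dec-true (together? A B (src g) (tgt g)) (together-src-tgt joins t) = ≡.refl

    pt≡1 : ∀ {g u v} → Joins g u v → ¬ Together A B u v → pt A B g ≡ 1#
    pt≡1 {g} joins ¬t rewrite dec-false (together? A B (src g) (tgt g)) (¬t ∘ src-tgt-together joins) = ≡.refl

    pt≈0⇒together : ∀ {g u v} → Joins g u v → pt A B g ≈ 0# → Together A B u v
    pt≈0⇒together {g} {u} {v} joins pt≈0 with together? A B u v
    ... | yes t = t
    ... | no ¬t = contradiction (trans (sym pt≈0) (reflexive (pt≡1 joins ¬t))) 0≉1

    pt-binary : Binary (pt A B)
    pt-binary g with does (together? A B (src g) (tgt g))
    ... | true  = inj₁ refl
    ... | false = inj₂ refl

    module _ (A∩B : Disjoint A B) where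

      zeroWalk⇒together : ∀ {u v} (p : Walk G′ E u v) → (∀ {e} → e ∈ˡ edges G′ p → pt A B e ≈ 0#) → u ≡ v ⊎ Together A B u v
      zeroWalk⇒together ε _ = inj₁ ≡.refl
      zeroWalk⇒together ((e , _ , joins) ◅ p) zs with pt≈0⇒together joins (zs (here ≡.refl)) | zeroWalk⇒together p (zs ∘ there)
      ... | t | inj₁ ≡.refl = inj₂ t
      ... | t | inj₂ t′     = inj₂ (together-trans A∩B t t′)

      pt-path-≤ : ∀ {f v w P} → Joins f v w → IsPath G′ E v w P → pt A B f ≤ sumOver P (pt A B)
      pt-path-≤ {f} {v} {w} joins (p , uniq , isP) =
        ≤-respʳ-≈ (sym (sumOver≈sumL (pt A B) (unique-edges p uniq) isP)) pt≤
        where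
        pt≤ : pt A B f ≤ sumL (edges G′ p) (pt A B)
        pt≤ with allZero⊎1≤sumL pt-binary (edges G′ p)
        ... | inj₂ 1≤ = ≤-trans (binary-≤1 pt-binary f) 1≤
        ... | inj₁ zs with zeroWalk⇒together p zs
        ...   | inj₁ v≡w = contradiction v≡w (joins-≢ joins)
        ...   | inj₂ t   = ≤-respˡ-≈ (sym (reflexive (pt≡0 joins t))) (0≤sumL pt-binary (edges G′ p))

      -- Connectedness of the blocks enters through the cut inequalities: the ends of an uncut `f`
      -- are joined by a walk within their block, and an edge where it meets the cut contributes 1
      -- to the right side.
      pt∈X : ConnectedIn E A → ConnectedIn E B → X (pt A B)
      pt∈X connA connB = record
        { binary = pt-binary
        ; cycle  = λ C isC e e∈C → case cycle⇒path isC e∈C of λ (_ , _ , joins , isP) → pt-path-≤ joins isP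
        ; path   = λ f v w _ joins P isP → pt-path-≤ joins isP
        ; cut    = cut
        }
        where
        crossing : ∀ {C S v w} → (∀ {a b} → a ∈ˡ S → b ∈ˡ S → Together A B a b) → Star (Link E S) v w →
                   Walk G′ (E ─ C) v w ⊎ ∃[ e ] e ∈ C × pt A B e ≡ 0#
        crossing _ ε = inj₁ ε
        crossing {C} S⇒ (((e , e∈E , joins) , a∈ , b∈) ◅ walk) with e ∈? C | crossing S⇒ walk
        ... | yes e∈C | _            = inj₂ (e , e∈C , pt≡0 joins (S⇒ a∈ b∈))
        ... | no e∉C  | inj₂ found   = inj₂ found
        ... | no e∉C  | inj₁ walk′   = inj₁ ((e , x∈p∧x∉q⇒x∈p─q e∈E e∉C , joins) ◅ walk′)
        blockWalk : ∀ {C v w} → Together A B v w → Walk G′ (E ─ C) v w ⊎ ∃[ e ] e ∈ C × pt A B e ≡ 0#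
        blockWalk (inj₁ (v∈ , w∈)) = crossing (λ a∈ b∈ → inj₁ (a∈ , b∈)) (connA v∈ w∈)
        blockWalk (inj₂ (v∈ , w∈)) = crossing (λ a∈ b∈ → inj₂ (a∈ , b∈)) (connB v∈ w∈)
        1-0≈1 : 1# - 0# ≈ 1#
        1-0≈1 = solve 0 (con (+ 1) :- con (+ 0) := con (+ 1)) refl
        cut : ∀ f v w → f ∉ E → Joins f v w → ∀ C → IsCut G′ E v w C → 1# - pt A B f ≤ sumOver C (λ e → 1# - pt A B e)
        cut f v w _ joins C ((_ , separated) , _) = bound (pt-binary f)
          where
          term : Fin m → Carrier
          term e = if lookup C e then 1# - pt A B e else 0#
          0≤term : ∀ e → 0# ≤ term e
          0≤term e with lookup C e | pt-binary e
          ... | false | _         = ≤-refl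
          ... | true  | inj₁ pt≈0 = ≤-respʳ-≈ (sym (trans (+-congˡ (-‿cong pt≈0)) 1-0≈1)) 0≤1
          ... | true  | inj₂ pt≈1 = ≤-reflexive (sym (trans (+-congˡ (-‿cong pt≈1)) (-‿inverseʳ 1#)))
          bound : pt A B f ≈ 0# ⊎ pt A B f ≈ 1# → 1# - pt A B f ≤ sum term
          bound (inj₂ pt≈1) = ≤-respˡ-≈ (sym (trans (+-congˡ (-‿cong pt≈1)) (-‿inverseʳ 1#))) (0≤sum term 0≤term)
          bound (inj₁ pt≈0) with blockWalk {C} (pt≈0⇒together joins pt≈0)
          ... | inj₁ walk = contradiction walk separated
          ... | inj₂ (e , e∈C , pt≡0′) = ≤-respˡ-≈ (sym (trans (+-congˡ (-‿cong pt≈0)) (sym term≈1-0))) (term≤sum term 0≤term e)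
            where
            term≈1-0 : term e ≈ 1# - 0#
            term≈1-0 rewrite []=⇒lookup e∈C | pt≡0′ = refl

-- The two directions for a path

module PathFacet {c ℓ₁ ℓ₂ : Level} (K : OrderedField c ℓ₁ ℓ₂) {n m : ℕ} (G′ : Graph n m) (E : Subset m)
            (connected : IsConnected G′ E) {v w : Fin n} (p : Walk G′ E v w) (uniq : Unique (nodes G′ p))
            {f : Fin m} (joins-f : Graph.Joins G′ f v w) (f∉p : f ∉ˡ edges G′ p)
            {P : Subset m} (isP : IsEdgeSetOf G′ P p) where
  open OrderedField K using (_≤_; +-monoʳ-≤; 0≉1)
  open Scalars K
  open Polyhedral K
  open LiftedMulticut K G′ E
  open Graph G′
  open Walks G′
  open Points K G′ E
  open SetoidReasoning setoid

  S⇒gap≈0 : ∀ {x} → S-path f P x → gap f (edges G′ p) ∙ x ≈ 0#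
  S⇒gap≈0 {x} (_ , tight) = ⇒gap≈0 {f} {edges G′ p} (trans tight (sumOver≈sumL x (unique-edges p uniq) isP))

  gap≈0⇒S : ∀ {x} → X x → gap f (edges G′ p) ∙ x ≈ 0# → S-path f P x
  gap≈0⇒S {x} Xx eq = Xx , trans (gap≈0⇒ {f} {edges G′ p} eq) (sym (sumOver≈sumL x (unique-edges p uniq) isP))

  Σ⊆Ξ : ∀ {x} → Σ-path f P x → Ξ x
  Σ⊆Ξ (k , q , coeff , Sq , rest) = k , q , coeff , proj₁ ∘ Sq , rest

  C : Subset m
  C = P ∪ ⁅ f ⁆

  node⇒∈ : ∀ {u} → _isNodeOf_ G′ u C → u ∈ˡ nodes G′ p
  node⇒∈ {u} (e , e∈C , u′ , joins) with x∈p∪q⁻ P ⁅ f ⁆ e∈C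
  ... | inj₁ e∈P = proj₁ (ends∈nodes p (Equivalence.to (isP e) e∈P) joins)
  ... | inj₂ e∈f with x∈⁅y⁆⇒x≡y f e∈f
  ...   | ≡.refl with joins-ends joins joins-f
  ...     | inj₁ (≡.refl , _) = here ≡.refl
  ...     | inj₂ (≡.refl , _) = last∈nodes p

  ∈C⁻ : ∀ {g} → g ∈ C → g ∈ˡ edges G′ p ⊎ g ≡ f
  ∈C⁻ {g} g∈C with x∈p∪q⁻ P ⁅ f ⁆ g∈C
  ... | inj₁ g∈P = inj₁ (Equivalence.to (isP g) g∈P)
  ... | inj₂ g∈f = inj₂ (x∈⁅y⁆⇒x≡y f g∈f)

  ∈C⁺ : ∀ {g} → g ∈ˡ edges G′ p ⊎ g ≡ f → g ∈ C
  ∈C⁺ {g} (inj₁ g∈p)   = x∈p∪q⁺ (inj₁ (Equivalence.from (isP g) g∈p))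
  ∈C⁺ (inj₂ ≡.refl)    = x∈p∪q⁺ {p = P} (inj₂ (x∈⁅x⁆ f))

  ones : Vector Carrier m
  ones = pt [] []

  ones∈X : X ones
  ones∈X = pt∈X (λ ()) (connected-[] E) (connected-[] E)

  -- At `ones` the gap is 1 minus the length of `q`. A walk joining the ends of `g` without using
  -- `g` has at least two edges, the graph being simple.
  multi-edge : ∀ {g a b} (q : Walk G′ E a b) → Joins g a b → g ∉ˡ edges G′ q → ¬ (gap g (edges G′ q) ∙ ones ≈ 0#)
  multi-edge ε joins _ _ = joins-irrefl joins
  multi-edge ((e , _ , joins′) ◅ ε) joins g∉q _ = g∉q (here (simple joins joins′))
  multi-edge {g} (s@(e , _) ◅ q@((e′ , _) ◅ _)) joins g∉q eq with allZero⊎1≤sumL (pt-binary {[]} {[]}) (edges G′ q)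
  ... | inj₁ zs = 0≉1 (sym (zs {e′} (here ≡.refl)))
  ... | inj₂ 1≤ = 1≰0 (≤-respʳ-≈ sum≈0 1≤)
    where
    sum≈0 : sumL (edges G′ q) ones ≈ 0#
    sum≈0 = begin
      sumL (edges G′ q) ones                     ≈⟨ solve 2 (λ a s → s := (a :+ s) :- a) refl 1# _ ⟩
      (1# + sumL (edges G′ q) ones) - 1#         ≈⟨ +-congʳ (gap≈0⇒ {g} {edges G′ (s ◅ q)} eq) ⟨
      1# - 1#                                    ≈⟨ -‿inverseʳ 1# ⟩
      0#                                         ∎

  δ-≢ : ∀ e g → e ≢ g → δ e g ≈ 0#
  δ-≢ e g e≢g with e ≟ g
  ... | yes e≡g = contradiction e≡g e≢g
  ... | no _    = refl

  δ-≡ : ∀ e → δ e e ≈ 1#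
  δ-≡ e with e ≟ e
  ... | yes _  = refl
  ... | no e≢e = contradiction ≡.refl e≢e

  sumL-δ-∉ : ∀ {e} L → e ∉ˡ L → sumL L (δ e) ≈ 0#
  sumL-δ-∉ {e} L e∉L = sumL-≈0 L (δ e) λ {g} g∈L → δ-≢ e g λ { ≡.refl → e∉L g∈L }

  sumL-δ-∈ : ∀ {e} L → Unique L → e ∈ˡ L → sumL L (δ e) ≈ 1#
  sumL-δ-∈ {e} (_ ∷ L) uniqL (here ≡.refl) = trans (+-cong (δ-≡ e) (sumL-δ-∉ L (unique-head uniqL))) (+-identityʳ 1#)
  sumL-δ-∈ {e} (g ∷ L) uniqL@(_ ∷ uniqL′) (there e∈L) =
    trans (+-cong (δ-≢ e g λ { ≡.refl → unique-head uniqL e∈L }) (sumL-δ-∈ L uniqL′ e∈L)) (+-identityˡ 1#)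

  ∙-+ʳ : ∀ (a x y : Vector Carrier m) → a ∙ (λ j → x j + y j) ≈ a ∙ x + a ∙ y
  ∙-+ʳ a x y = trans (sum-cong-≋ (λ j → distribˡ (a j) (x j) (y j))) (∑-distrib-+ (λ j → a j * x j) (λ j → a j * y j))

  -- A chord and the second hyperplane it forces

  module Chord {a b} (p₁ : Walk G′ E v a) (q : Walk G′ E a b) (p₂ : Walk G′ E b w) (split : p ≡ p₁ ◅◅ (q ◅◅ p₂))
               {g} (joins-g : Joins g a b) (g∉C : g ∉ C) where

    inner = edges G′ q
    outer = edges G′ p₁ ++ edges G′ p₂

    edges-p : edges G′ p ≡ edges G′ p₁ ++ (inner ++ edges G′ p₂)
    edges-p = ≡.trans (≡.cong (edges G′) split) (≡.trans (edges-◅◅ p₁ _) (≡.cong (edges G′ p₁ ++_) (edges-◅◅ q p₂)))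

    outer⊆ : ∀ {e} → e ∈ˡ outer → e ∈ˡ edges G′ p
    outer⊆ e∈ rewrite edges-p with ∈-++⁻ (edges G′ p₁) e∈
    ... | inj₁ e∈₁ = ∈-++⁺ˡ e∈₁
    ... | inj₂ e∈₂ = ∈-++⁺ʳ (edges G′ p₁) (∈-++⁺ʳ inner e∈₂)

    inner⊆ : ∀ {e} → e ∈ˡ inner → e ∈ˡ edges G′ p
    inner⊆ e∈ rewrite edges-p = ∈-++⁺ʳ (edges G′ p₁) (∈-++⁺ˡ e∈)

    outer∩inner : ∀ {e} → e ∈ˡ outer → e ∉ˡ inner
    outer∩inner e∈ e∈q with ∈-++⁻ (edges G′ p₁) e∈
    ... | inj₁ e∈₁ = unique-disjoint (edges G′ p₁) (≡.subst Unique edges-p (unique-edges p uniq)) e∈₁ (∈-++⁺ˡ e∈q)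
    ... | inj₂ e∈₂ = unique-disjoint inner (unique-++ʳ (edges G′ p₁) (≡.subst Unique edges-p (unique-edges p uniq))) e∈q e∈₂

    uniq-q : Unique (nodes G′ q)
    uniq-q = unique-++ˡ (nodes G′ q) (≡.subst Unique (nodes-◅◅ q p₂)
      (unique-++ʳ (initNodes p₁) (≡.subst Unique (≡.trans (≡.cong (nodes G′) split) (nodes-init p₁ _)) uniq)))

    g∉p : g ∉ˡ edges G′ p
    g∉p g∈p = g∉C (∈C⁺ (inj₁ g∈p))

    sum-p : ∀ x → sumL (edges G′ p) x ≈ sumL inner x + sumL outer x
    sum-p x = begin
      sumL (edges G′ p) x
        ≡⟨ ≡.cong (λ L → sumL L x) edges-p ⟩
      sumL (edges G′ p₁ ++ (inner ++ edges G′ p₂)) x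
        ≈⟨ trans (sumL-++ (edges G′ p₁) _ x) (+-congˡ (sumL-++ inner _ x)) ⟩
      sumL (edges G′ p₁) x + (sumL inner x + sumL (edges G′ p₂) x)
        ≈⟨ solve 3 (λ a b c → a :+ (b :+ c) := b :+ (a :+ c)) refl _ _ _ ⟩
      sumL inner x + (sumL (edges G′ p₁) x + sumL (edges G′ p₂) x)
        ≈⟨ +-congˡ (sumL-++ (edges G′ p₁) _ x) ⟨
      sumL inner x + sumL outer x ∎

    -- If `q` were all of `p`, the chord would join the ends of `f` and hence equal `f`, an edge of
    -- the cycle.
    outer-nonempty : ∃[ e ] e ∈ˡ outer
    outer-nonempty = go p₁ p₂ joins-g
      where
      go : ∀ {a b} (p₁ : Walk G′ E v a) (p₂ : Walk G′ E b w) → Joins g a b → ∃[ e ] e ∈ˡ edges G′ p₁ ++ edges G′ p₂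
      go ε             ε             joins = ⊥-elim (g∉C (∈C⁺ (inj₂ (simple joins joins-f))))
      go ((e , _) ◅ _) _             _     = e , here ≡.refl
      go ε             ((e , _) ◅ _) _     = e , here ≡.refl

    -- If g is uncut and no edge of P outside q is cut, then the ends of f stay
    -- connected, so f is uncut as well.
    tight : ∀ x → S-path f P x → gap g inner ∙ x ≈ 0#
    tight x Sx@(Xx , _) = ⇒gap≈0 {g} {inner} (tight′ (binary g) (binary f))
      where
      open X Xx
      open Feasible Xx
      xf≈ : x f ≈ sumL inner x + sumL outer x
      xf≈ = trans (gap≈0⇒ {f} {edges G′ p} (S⇒gap≈0 Sx)) (sum-p x)
      inner≤xf : sumL inner x ≤ x f
      inner≤xf = ≤-respˡ-≈ (+-identityʳ _) (≤-respʳ-≈ (sym xf≈) (+-monoʳ-≤ (sumL inner x) (0≤sumL binary outer)))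
      zeroWalk : ∀ {u u′} (r : Walk G′ E u u′) → (∀ {e} → e ∈ˡ edges G′ r → x e ≈ 0#) → Walk G′ zeros u u′
      zeroWalk ε                       zs = ε
      zeroWalk ((e , e∈E , joins) ◅ r) zs = (e , ∈zeros⁺ e∈E (zs (here ≡.refl)) , joins) ◅ zeroWalk r (zs ∘ there)
      tight′ : x g ≈ 0# ⊎ x g ≈ 1# → x f ≈ 0# ⊎ x f ≈ 1# → x g ≈ sumL inner x
      tight′ (inj₂ xg≈1) _ = antisym (path-≤ q uniq-q joins-g (g∉p ∘ inner⊆))
        (≤-respʳ-≈ (sym xg≈1) (≤-trans inner≤xf (binary-≤1 binary f)))
      tight′ (inj₁ xg≈0) (inj₁ xf≈0) = trans xg≈0 (antisym (0≤sumL binary inner) (≤-respʳ-≈ xf≈0 inner≤xf))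
      tight′ (inj₁ xg≈0) (inj₂ xf≈1) with allZero⊎1≤sumL binary outer
      -- This case is refuted, so a walk known only up to double negation suffices.
      ... | inj₁ zs = ⊥-elim (≈0⇒¬¬zeroWalk joins-g xg≈0 λ walk → 0≉1 (trans (sym (zeroWalk⇒≈0
              (zeroWalk p₁ (zs ∘ ∈-++⁺ˡ) ◅◅ (walk ◅◅ zeroWalk p₂ (zs ∘ ∈-++⁺ʳ (edges G′ p₁)))) joins-f)) xf≈1))
      ... | inj₂ 1≤ = trans xg≈0 (antisym (0≤sumL binary inner) inner≤0)
        where
        inner≤0 : sumL inner x ≤ 0#
        inner≤0 = ≤-respˡ-≈ (solve 2 (λ a b → :- a :+ (b :+ a) := b) refl 1# (sumL inner x))
          (≤-respʳ-≈ (-‿inverseˡ 1#) (+-monoʳ-≤ (- 1#)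
            (≤-respʳ-≈ (trans (sym xf≈) xf≈1) (+-monoʳ-≤ (sumL inner x) 1≤))))

    -- The d + 1 independent points `r` of Σ are extended by `ones`, off the hyperplane of the
    -- chord, and by `u₂`, off a hyperplane containing `r` and `ones`. These are d + 3 independent
    -- points of Ξ, whose dimension d + 1 allows d + 2.
    ¬facet : ¬ IsFacet (Σ-path f P) Ξ
    ¬facet (_ , d , (_ , bound) , ((r , Σr , indep) , _)) = ℕ.1+n≰n (bound (suc (suc (suc d))) (u₂ ∷ᵛ ones ∷ᵛ r)
        (λ { zero → conv-⊇ {A = X} u₂∈X ; (suc zero) → conv-⊇ {A = X} ones∈X ; (suc (suc i)) → Σ⊆Ξ (Σr i) })
        (affine-extend h u₂ (ones ∷ᵛ r) (λ { zero → h∙ones ; (suc i) → h∙r i }) h∙u₂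
          (affine-extend h₂ ones r (λ i → ∙-conv-≈0 h₂ tight (Σr i)) h₂∙ones indep)))
      where
      e = proj₁ outer-nonempty
      e∈outer = proj₂ outer-nonempty
      u₂ = pt (src e ∷ tgt e ∷ []) []
      h₁ = gap f (edges G′ p)
      h₂ = gap g inner
      s = h₁ ∙ ones
      l = h₂ ∙ ones
      -- The combination of the two gaps that vanishes at `ones`. Lowering the coordinate of the
      -- outer edge `e` by 1 changes the value of `h₁` but not of `h₂`, so `h ∙ u₂` equals `l`.
      h : Vector Carrier m
      h j = l * h₁ j + - s * h₂ j
      u₂∈X : X u₂
      u₂∈X = pt∈X (λ _ ()) (connected-∷ E (e , edges⊆ p (outer⊆ e∈outer) , joins-self e) (here ≡.refl) (connected-[_] E (tgt e))) (connected-[] E)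
      h₂∙ones : ¬ (l ≈ 0#)
      h₂∙ones = multi-edge q joins-g (g∉p ∘ inner⊆)
      h-∙ : ∀ x → h ∙ x ≈ l * (h₁ ∙ x) + - s * (h₂ ∙ x)
      h-∙ x = trans (∙-+ (λ j → l * h₁ j) (λ j → - s * h₂ j) x) (+-cong (∙-scale l h₁ x) (∙-scale (- s) h₂ x))
      h∙ones : h ∙ ones ≈ 0#
      h∙ones = trans (h-∙ ones) (solve 2 (λ l s → l :* s :+ :- s :* l := con (+ 0)) refl l s)
      h∙r : ∀ i → h ∙ r i ≈ 0#
      h∙r i = trans (h-∙ (r i)) (trans (+-cong (*-congˡ (∙-conv-≈0 h₁ (λ _ → S⇒gap≈0) (Σr i))) (*-congˡ (∙-conv-≈0 h₂ tight (Σr i))))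
        (solve 2 (λ l s → l :* con (+ 0) :+ :- s :* con (+ 0) := con (+ 0)) refl l s))
      ones≈ : ∀ j → ones j ≈ u₂ j + δ e j
      -- Contracting `e` unites only its two ends, and no other edge joins them.
      ones≈ j with e ≟ j
      ... | yes ≡.refl = sym (trans (+-congʳ (reflexive (pt≡0 {src e ∷ tgt e ∷ []} {[]} (joins-self e) (inj₁ (here ≡.refl , there (here ≡.refl)))))) (+-identityˡ 1#))
      ... | no e≢j = sym (trans (+-identityʳ _) (reflexive (pt≡1 (joins-self j) apart)))
        where
        apart : ¬ Together (src e ∷ tgt e ∷ []) [] (src j) (tgt j)
        apart (inj₁ (here s≡s , here t≡s)) = loopless j (≡.trans s≡s (≡.sym t≡s))
        apart (inj₁ (here s≡s , there (here t≡t))) = e≢j (simple (joins-self e) (inj₁ (s≡s , t≡t)))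
        apart (inj₁ (there (here s≡t) , here t≡s)) = e≢j (simple (joins-self e) (inj₂ (s≡t , t≡s)))
        apart (inj₁ (there (here s≡t) , there (here t≡t))) = loopless j (≡.trans s≡t (≡.sym t≡t))
      h₁∙δ : h₁ ∙ δ e ≈ - 1#
      h₁∙δ = trans (gap-∙ f (edges G′ p) (δ e)) (trans (+-cong (δ-≢ e f λ e≡f → f∉p (≡.subst (_∈ˡ _) e≡f (outer⊆ e∈outer)))
        (-‿cong (sumL-δ-∈ (edges G′ p) (unique-edges p uniq) (outer⊆ e∈outer)))) (+-identityˡ _))
      h₂∙δ : h₂ ∙ δ e ≈ 0#
      h₂∙δ = trans (gap-∙ g inner (δ e)) (trans (+-cong (δ-≢ e g λ e≡g → g∉p (≡.subst (_∈ˡ _) e≡g (outer⊆ e∈outer)))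
        (-‿cong (sumL-δ-∉ inner (outer∩inner e∈outer)))) (-‿inverseʳ 0#))
      h∙δ : h ∙ δ e ≈ - l
      h∙δ = trans (h-∙ (δ e)) (trans (+-cong (*-congˡ h₁∙δ) (*-congˡ h₂∙δ))
        (solve 2 (λ l s → l :* :- con (+ 1) :+ :- s :* con (+ 0) := :- l) refl l s))
      h∙u₂ : ¬ (h ∙ u₂ ≈ 0#)
      h∙u₂ eq = h₂∙ones (begin
        l                              ≈⟨ solve 1 (λ l → l := :- (con (+ 0) :+ :- l)) refl l ⟩
        - (0# + - l)                   ≈⟨ -‿cong (+-cong (sym eq) (sym h∙δ)) ⟩
        - (h ∙ u₂ + h ∙ δ e)           ≈⟨ -‿cong (∙-+ʳ h u₂ (δ e)) ⟨
        - (h ∙ (λ j → u₂ j + δ e j))   ≈⟨ -‿cong (∙-congʳ h ones≈) ⟨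
        - (h ∙ ones)                   ≈⟨ -‿cong h∙ones ⟩
        - 0#                           ≈⟨ solve 0 (:- con (+ 0) := con (+ 0)) refl ⟩
        0#                             ∎)

  facet⇒chordless : IsFacet (Σ-path f P) Ξ → IsChordless G′ C
  facet⇒chordless facet g a b g∉C joins (a-node , b-node) with splitNode p (node⇒∈ a-node)
  ... | p₁ , p₂ , split with ∈-++⁻ (nodes G′ p₁) (≡.subst (b ∈ˡ_) (≡.trans (≡.cong (nodes G′) split) (nodes-◅◅ p₁ p₂)) (node⇒∈ b-node))
  -- `b` does not come after `a` on the path, so the chord is read in the other direction.
  ...   | inj₁ b∈p₁ with splitNode p₁ b∈p₁
  ...     | q₁ , q , ≡.refl = Chord.¬facet q₁ q p₂ (≡.trans split (◅◅-assoc q₁ q p₂)) (joins-sym joins) g∉C facet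
  facet⇒chordless facet g a b g∉C joins (a-node , b-node) | p₁ , p₂ , split | inj₂ b∈p₂ with splitNode p₂ (there b∈p₂)
  ...     | q , q₂ , ≡.refl = Chord.¬facet p₁ q q₂ split joins g∉C facet

  -- Decompositions tight for the path

  W : List (Fin n)
  W = nodes G′ p

  data Covers : List (Fin n) → List (Fin n) → Set where
    whole : ∀ {A B} → (∀ {u} → u ∈ˡ W → u ∈ˡ A) → Covers A B
    split : ∀ {A B a b} (p₁ : Walk G′ E v a) (s : Step G′ E a b) (p₂ : Walk G′ E b w) → p ≡ p₁ ◅◅ s ◅ p₂ →
            (∀ {u} → u ∈ˡ nodes G′ p₁ → u ∈ˡ A) → (∀ {u} → u ∈ˡ nodes G′ p₂ → u ∈ˡ B) → Covers A B
    swap  : ∀ {A B} → Covers A B → Covers B A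

  together-swap : ∀ {A B u u′} → Together A B u u′ → Together B A u u′
  together-swap (inj₁ t) = inj₂ t
  together-swap (inj₂ t) = inj₁ t

  -- Both sides are 0 if the path is whole. If it is split, `f` and the splitting edge are cut, the
  -- rest of the path is not, and both sides are 1. `x` is abstract so that `swap` can recurse
  -- without identifying the points of (A, B) and (B, A).
  covers⇒tight : ∀ {A B} → Disjoint A B → Covers A B → (x : Vector Carrier m) →
                 (∀ {g u u′} → Joins g u u′ → Together A B u u′ → x g ≈ 0#) →
                 (∀ {g u u′} → Joins g u u′ → ¬ Together A B u u′ → x g ≈ 1#) →
                 x f ≈ sumL (edges G′ p) x
  covers⇒tight A∩B (swap cov) x x≈0 x≈1 = covers⇒tight (λ u∈B u∈A → A∩B u∈A u∈B) cov x
    (λ joins t → x≈0 joins (together-swap t)) (λ joins ¬t → x≈1 joins (¬t ∘ together-swap))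
  covers⇒tight A∩B (whole W⊆A) x x≈0 x≈1 = trans (x≈0 joins-f (inj₁ (W⊆A (here ≡.refl) , W⊆A (last∈nodes p))))
    (sym (sumL-≈0 (edges G′ p) x λ {e} e∈ → case ends∈nodes p e∈ (joins-self e) of λ (s∈ , t∈) → x≈0 (joins-self e) (inj₁ (W⊆A s∈ , W⊆A t∈))))
  covers⇒tight {A} {B} A∩B (split p₁ s@(e , _ , joins) p₂ eq p₁⊆A p₂⊆B) x x≈0 x≈1 = begin
    x f                                                    ≈⟨ x≈1 joins-f (apart (p₁⊆A (here ≡.refl)) (p₂⊆B (last∈nodes p₂))) ⟩
    1#                                                     ≈⟨ x≈1 joins (apart (p₁⊆A (last∈nodes p₁)) (p₂⊆B (here ≡.refl))) ⟨
    x e                                                    ≈⟨ solve 1 (λ a → a := con (+ 0) :+ (a :+ con (+ 0))) refl (x e) ⟩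
    0# + (x e + 0#)                                        ≈⟨ +-cong (sumL-≈0 (edges G′ p₁) x zero₁) (+-congˡ (sumL-≈0 (edges G′ p₂) x zero₂)) ⟨
    sumL (edges G′ p₁) x + (x e + sumL (edges G′ p₂) x)    ≈⟨ sumL-++ (edges G′ p₁) (e ∷ edges G′ p₂) x ⟨
    sumL (edges G′ p₁ ++ e ∷ edges G′ p₂) x                ≡⟨ ≡.cong (λ L → sumL L x) (≡.trans (≡.cong (edges G′) eq) (edges-◅◅ p₁ (s ◅ p₂))) ⟨
    sumL (edges G′ p) x                                    ∎
    where
    apart : ∀ {u u′} → u ∈ˡ A → u′ ∈ˡ B → ¬ Together A B u u′
    apart u∈A u′∈B (inj₁ (_ , u′∈A)) = A∩B u′∈A u′∈B
    apart u∈A u′∈B (inj₂ (u∈B , _))  = A∩B u∈A u∈B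
    zero₁ : ∀ {d} → d ∈ˡ edges G′ p₁ → x d ≈ 0#
    zero₁ {d} d∈ with ends∈nodes p₁ d∈ (joins-self d)
    ... | s∈ , t∈ = x≈0 (joins-self d) (inj₁ (p₁⊆A s∈ , p₁⊆A t∈))
    zero₂ : ∀ {d} → d ∈ˡ edges G′ p₂ → x d ≈ 0#
    zero₂ {d} d∈ with ends∈nodes p₂ d∈ (joins-self d)
    ... | s∈ , t∈ = x≈0 (joins-self d) (inj₂ (p₂⊆B s∈ , p₂⊆B t∈))

  covers-⊇ : ∀ {A A′ B B′} → (∀ {u} → u ∈ˡ A → u ∈ˡ A′) → (∀ {u} → u ∈ˡ B → u ∈ˡ B′) → Covers A B → Covers A′ B′
  covers-⊇ A⊆ B⊆ (whole W⊆A)                  = whole (A⊆ ∘ W⊆A)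
  covers-⊇ A⊆ B⊆ (split p₁ s p₂ eq ⊆A ⊆B)     = split p₁ s p₂ eq (A⊆ ∘ ⊆A) (B⊆ ∘ ⊆B)
  covers-⊇ A⊆ B⊆ (swap cov)                   = swap (covers-⊇ B⊆ A⊆ cov)

  record Good (A B : List (Fin n)) : Set where
    field
      disjoint : Disjoint A B
      connA    : ConnectedIn E A
      connB    : ConnectedIn E B
      covers   : Covers A B

  good∈S : ∀ {A B} → Good A B → S-path f P (pt A B)
  good∈S {A} {B} good = gap≈0⇒S (pt∈X disjoint connA connB) (⇒gap≈0 {f} {edges G′ p}
    (covers⇒tight disjoint covers (pt A B) (λ joins t → reflexive (pt≡0 joins t)) (λ joins ¬t → reflexive (pt≡1 joins ¬t))))
    where open Good good

  -- Integer combinations of tight points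

  data Span : (Fin m → ℤ) → Set where
    gen   : ∀ {A B} → Good A B → Span (ptℤ A B)
    _⊞_   : ∀ {x y} → Span x → Span y → Span (λ g → x g ℤ.+ y g)
    mult  : ∀ k {x} → Span x → Span (λ g → k ℤ.* x g)
    resp  : ∀ {x y} → (∀ g → x g ≡ y g) → Span x → Span y

  -- A functional that vanishes on all generators vanishes on the span; zero tests in ℤ turn this
  -- around and find the generator.
  span-detect : ∀ {φ} → Linear φ → ∀ {x} → Span x → φ x ≢ + 0 → ∃[ A ] ∃[ B ] Good A B × φ (ptℤ A B) ≢ + 0
  span-detect lin (gen good) φx≢0 = _ , _ , good , φx≢0
  span-detect {φ} lin (_⊞_ {x} {y} sx sy) φ≢0 with φ x ℤ.≟ + 0
  ... | no φx≢0  = span-detect lin sx φx≢0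
  ... | yes φx≡0 = span-detect lin sy λ φy≡0 → φ≢0 (≡.trans (Linear.add lin x y) (≡.cong₂ ℤ._+_ φx≡0 φy≡0))
  span-detect {φ} lin (mult k {x} sx) φ≢0 = span-detect lin sx λ φx≡0 →
    φ≢0 (≡.trans (Linear.scale lin k x) (≡.trans (≡.cong (k ℤ.*_) φx≡0) (ℤ.*-zeroʳ k)))
  span-detect lin (resp x≡y sx) φy≢0 = span-detect lin sx λ φx≡0 → φy≢0 (≡.trans (≡.sym (Linear.cong lin x≡y)) φx≡0)

  _⊟_ : ∀ {x y} → Span x → Span y → Span (λ g → x g ℤ.- y g)
  _⊟_ {x} {y} sx sy = resp (λ g → ≡.cong (ℤ._+_ (x g)) (ℤ.-1*i≡-i (y g))) (sx ⊞ mult (ℤ.- + 1) sy)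

  -- `B` stays fixed, so its contribution cancels, and of `inside (b ∷ M)` only the star from `b` to
  -- `M` is left.
  span-between : ∀ {b M B} → b ∉ˡ M → Good (b ∷ M) B → Good M B → Span (between b M)
  span-between {b} {M} {B} b∉M good∷ good = resp difference (gen good ⊟ gen good∷)
    where
    cancel : ∀ x y z → (+ 1 ℤ.- x ℤ.- z) ℤ.- (+ 1 ℤ.- (y ℤ.+ x) ℤ.- z) ≡ y
    cancel = solve-∀
    difference : ∀ g → ptℤ M B g ℤ.- ptℤ (b ∷ M) B g ≡ between b M g
    difference g = ≡.trans (≡.cong₂ ℤ._-_ (ptℤ-inside (Good.disjoint good) g)
      (≡.trans (ptℤ-inside (Good.disjoint good∷) g) (≡.cong (λ z → + 1 ℤ.- z ℤ.- inside B g) (inside-∷ b∉M g))))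
      (cancel (inside M g) (between b M g) (inside B g))

  span-pair : ∀ {a b M} → b ∉ˡ M → Span (between a (b ∷ M)) → Span (between a M) → Span (pair a b)
  span-pair {a} {b} {M} b∉M sbM sM = resp difference (sbM ⊟ sM)
    where
    cancel : ∀ x y → (x ℤ.+ y) ℤ.- y ≡ x
    cancel = solve-∀
    difference : ∀ g → between a (b ∷ M) g ℤ.- between a M g ≡ pair a b g
    difference g = ≡.trans (≡.cong (ℤ._- between a M g) (between-∷ b∉M g)) (cancel (pair a b g) (between a M g))

  -- Inclusion–exclusion over the four sets M, aM, bM, abM.
  span-pair₄ : ∀ {a b M B} → a ≢ b → a ∉ˡ M → b ∉ˡ M →
               Good (a ∷ b ∷ M) B → Good (b ∷ M) B → Good (a ∷ M) B → Good M B → Span (pair a b)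
  span-pair₄ a≢b a∉M b∉M abM bM aM M =
    span-pair b∉M (span-between (λ { (here a≡b) → a≢b a≡b ; (there a∈M) → a∉M a∈M }) abM bM) (span-between a∉M aM M)

  span-zero : Good W [] → Span (λ _ → + 0)
  span-zero good = mult (+ 0) (gen good)

  span-all : ∀ {b} M → Good W [] → (∀ {u} → u ∈ˡ M → Span (pair b u)) → Span (between b M)
  span-all {b} [] good _ = resp (λ g → empty (does (src g ≟ b)) (does (tgt g ≟ b))) (span-zero good)
    where
    empty : ∀ x y → + 0 ≡ bit (x ∧ false) ℤ.+ bit (false ∧ y)
    empty false _ = ≡.refl
    empty true  _ = ≡.refl
  span-all {b} (u ∷ M) good pairs with u ∈ˡ? M
  ... | no u∉M  = resp (λ g → ≡.sym (between-∷ u∉M g)) (pairs (here ≡.refl) ⊞ span-all M good (pairs ∘ there))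
  -- `between` depends only on membership, so a repeated `u` is skipped rather than counted twice.
  ... | yes u∈M = resp (between-cong there (λ { (here ≡.refl) → u∈M ; (there x∈) → x∈ })) (span-all M good (pairs ∘ there))

  -- Blocks within the path leave every node off the path free to join one of them.
  record Base (A B : List (Fin n)) : Set where
    field
      good : Good A B
      A⊆W  : ∀ {u} → u ∈ˡ A → u ∈ˡ W
      B⊆W  : ∀ {u} → u ∈ˡ B → u ∈ˡ W
    open Good good public

  base-whole : Base W []
  base-whole = record
    { good = record { disjoint = λ _ () ; connA = connected-nodes E p ; connB = connected-[] E ; covers = whole id }
    ; A⊆W = id ; B⊆W = λ () }

  base-cong : ∀ {A A′ B} → (∀ {x} → x ∈ˡ A → x ∈ˡ A′) → (∀ {x} → x ∈ˡ A′ → x ∈ˡ A) → Base A B → Base A′ B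
  base-cong A⊆ A⊇ base = record
    { good = record { disjoint = disjoint ∘ A⊇ ; connA = connected-cong E A⊆ A⊇ connA ; connB = connB ; covers = covers-⊇ A⊆ id covers }
    ; A⊆W = A⊆W ∘ A⊇ ; B⊆W = B⊆W }
    where open Base base

  base-swap : ∀ {A B} → Base A B → Base B A
  base-swap base = record
    { good = record { disjoint = λ u∈B u∈A → disjoint u∈A u∈B ; connA = connB ; connB = connA ; covers = swap covers }
    ; A⊆W = B⊆W ; B⊆W = A⊆W }
    where open Base base

  base-split : ∀ {a b} (p₁ : Walk G′ E v a) (s : Step G′ E a b) (p₂ : Walk G′ E b w) → p ≡ p₁ ◅◅ s ◅ p₂ →
               Base (nodes G′ p₁) (nodes G′ p₂)
  base-split p₁ s p₂ eq = record
    { good = record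
      { disjoint = unique-disjoint (nodes G′ p₁) (≡.subst Unique W≡ uniq)
      ; connA = connected-nodes E p₁ ; connB = connected-nodes E p₂
      ; covers = split p₁ s p₂ eq id id }
    ; A⊆W = λ {u} u∈ → ≡.subst (u ∈ˡ_) (≡.sym W≡) (∈-++⁺ˡ u∈)
    ; B⊆W = λ {u} u∈ → ≡.subst (u ∈ˡ_) (≡.sym W≡) (∈-++⁺ʳ (nodes G′ p₁) u∈) }
    where
    W≡ : W ≡ nodes G′ p₁ ++ nodes G′ p₂
    W≡ = ≡.trans (≡.cong (nodes G′) eq) (nodes-◅◅-◅ p₁ s p₂)

  -- A prefix with nothing after it has no following edge to split at; then the whole path serves,
  -- with an empty second block.
  base-prefix : ∀ {a} (p₁ : Walk G′ E v a) (p₂ : Walk G′ E a w) → p ≡ p₁ ◅◅ p₂ → ∃[ B ] Base (nodes G′ p₁) B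
  base-prefix p₁ ε eq = [] , ≡.subst (λ L → Base L []) W≡ base-whole
    where
    W≡ : W ≡ nodes G′ p₁
    W≡ = ≡.trans (≡.cong (nodes G′) eq) (≡.trans (nodes-◅◅ p₁ ε) (++-identityʳ (nodes G′ p₁)))
  base-prefix p₁ (s ◅ p₂) eq = nodes G′ p₂ , base-split p₁ s p₂ eq

  base-suffix : ∀ {a} (p₁ : Walk G′ E v a) (p₂ : Walk G′ E a w) → p ≡ p₁ ◅◅ p₂ → ∃[ B ] Base (nodes G′ p₂) B
  base-suffix p₁ p₂ eq with unsnoc p₁
  ... | nil      = [] , ≡.subst (λ L → Base L []) (≡.cong (nodes G′) eq) base-whole
  ... | snoc q s = nodes G′ q , base-swap (base-split q s p₂ (≡.trans eq (◅◅-assoc q (s ◅ ε) p₂)))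

  -- Moving the split of p past the node a adds a to the part that contains j.
  base-pair : ∀ {a j} → a ∈ˡ W → j ∈ˡ W → a ≢ j →
              ∃[ A ] ∃[ B ] ∃[ B′ ] Base A B × Base (a ∷ A) B′ × j ∈ˡ A × a ∉ˡ A
  base-pair {a} {j} a∈W j∈W a≢j with splitNode p a∈W
  ... | p₁ , p₂ , eq with ∈-++⁻ (nodes G′ p₁) (≡.subst (j ∈ˡ_) (≡.trans (≡.cong (nodes G′) eq) (nodes-◅◅ p₁ p₂)) j∈W)
  base-pair {a} {j} a∈W j∈W a≢j | p₁ , (s ◅ p₂) , eq | inj₂ j∈p₂ with base-suffix p₁ (s ◅ p₂) eq
  ... | B′ , base′ = nodes G′ p₂ , nodes G′ p₁ , B′ , base , base′ , j∈p₂ , λ a∈p₂ → Base.disjoint base a∈p₂ (last∈nodes p₁)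
    where
    base : Base (nodes G′ p₂) (nodes G′ p₁)
    base = base-swap (base-split p₁ s p₂ eq)
  base-pair {a} {j} a∈W j∈W a≢j | p₁ , p₂ , eq | inj₁ j∈p₁ with unsnoc p₁ | base-prefix p₁ p₂ eq
  base-pair {a} {j} a∈W j∈W a≢j | _ , p₂ , eq | inj₁ (here ≡.refl) | nil | _ = contradiction ≡.refl a≢j
  base-pair {a} {j} a∈W j∈W a≢j | _ , p₂ , eq | inj₁ j∈p₁ | snoc q s | B′ , base′ =
    nodes G′ q , nodes G′ p₂ , B′ , base , base-cong rotate unrotate base′ , j∈q , λ a∈q → Base.disjoint base a∈q (here ≡.refl)
    where
    nodes-∷ʳ : nodes G′ (q ◅◅ s ◅ ε) ≡ nodes G′ q ++ a ∷ []
    nodes-∷ʳ = nodes-◅◅-◅ q s ε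
    base : Base (nodes G′ q) (nodes G′ p₂)
    base = base-split q s p₂ (≡.trans eq (◅◅-assoc q (s ◅ ε) p₂))
    -- The prefix ending in `a` lists it last, whereas the block is wanted as `a` followed by the
    -- shorter prefix.
    rotate : ∀ {x} → x ∈ˡ nodes G′ (q ◅◅ s ◅ ε) → x ∈ˡ a ∷ nodes G′ q
    rotate {x} x∈ with ∈-++⁻ (nodes G′ q) (≡.subst (x ∈ˡ_) nodes-∷ʳ x∈)
    ... | inj₁ x∈q           = there x∈q
    ... | inj₂ (here ≡.refl) = here ≡.refl
    unrotate : ∀ {x} → x ∈ˡ a ∷ nodes G′ q → x ∈ˡ nodes G′ (q ◅◅ s ◅ ε)
    unrotate (here ≡.refl) = last∈nodes (q ◅◅ s ◅ ε)
    unrotate {x} (there x∈q) = ≡.subst (x ∈ˡ_) (≡.sym nodes-∷ʳ) (∈-++⁺ˡ x∈q)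
    j∈q : j ∈ˡ nodes G′ q
    j∈q with rotate j∈p₁
    ... | here ≡.refl = contradiction ≡.refl a≢j
    ... | there j∈q   = j∈q

  -- Isolating pairs of nodes

  v∈W : v ∈ˡ W
  v∈W = here ≡.refl

  -- If both tails reach the path, M is the path with both interiors, and either node can be added
  -- independently. If one tail ends in the other node, M is the interior of that tail, disjoint
  -- from the path, which forms the second block.
  span-outside : ∀ {a b} → a ∉ˡ W → b ∉ˡ W → a ≢ b → Span (pair a b)
  span-outside {a} {b} a∉W b∉W a≢b =
    -- Each tail stops at the other node as well, so that its interior contains neither `a` nor `b`.
    go (tail E (connected a v) (there v∈W) (λ { (here a≡b) → a≢b a≡b ; (there a∈W) → a∉W a∈W }))
       (tail E (connected b v) (there v∈W) (λ { (here b≡a) → a≢b (≡.sym b≡a) ; (there b∈W) → b∉W b∈W }))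
    where
    direct : ∀ {a b} → a ≢ b → (T : Tail E (b ∷ W) a) → a ∉ˡ W → b ∉ˡ W → Tail.end T ≡ b → Span (pair a b)
    direct {a} {b} a≢b T a∉W b∉W end≡b =
      span-pair₄ a≢b T.b∉ b∉M (good abM (connected-∷ E T.first next∈bM connbM)) (good bM connbM) (good aM T.conn-b∷) (good (T.avoids′) T.conn)
      where
      module T where
        open Tail T public
        avoids′ : ∀ {x} → x ∈ˡ interior → x ∉ˡ W
        avoids′ x∈ x∈W = avoids x∈ (there x∈W)
      M = T.interior
      b∉M : b ∉ˡ M
      b∉M b∈M = T.avoids b∈M (here ≡.refl)
      good : ∀ {A} → (∀ {x} → x ∈ˡ A → x ∉ˡ W) → ConnectedIn E A → Good A W
      good A∩W connA = record { disjoint = A∩W ; connA = connA ; connB = connected-nodes E p ; covers = swap (whole id) }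
      bM : ∀ {x} → x ∈ˡ b ∷ M → x ∉ˡ W
      bM (here ≡.refl) = b∉W
      bM (there x∈M)   = T.avoids′ x∈M
      aM : ∀ {x} → x ∈ˡ a ∷ M → x ∉ˡ W
      aM (here ≡.refl) = a∉W
      aM (there x∈M)   = T.avoids′ x∈M
      abM : ∀ {x} → x ∈ˡ a ∷ b ∷ M → x ∉ˡ W
      abM (here ≡.refl) = a∉W
      abM (there x∈bM)  = bM x∈bM
      to : ∀ {x} → x ∈ˡ M ++ b ∷ [] → x ∈ˡ b ∷ M
      to x∈ with ∈-++⁻ M x∈
      ... | inj₁ x∈M           = there x∈M
      ... | inj₂ (here ≡.refl) = here ≡.refl
      from : ∀ {x} → x ∈ˡ b ∷ M → x ∈ˡ M ++ b ∷ []
      from (here ≡.refl) = ∈-++⁺ʳ M (here ≡.refl)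
      from (there x∈M)   = ∈-++⁺ˡ x∈M
      connbM : ConnectedIn E (b ∷ M)
      connbM = connected-cong E to from (T.attach (here end≡b) (connected-[_] E b))
      next∈bM : T.next ∈ˡ b ∷ M
      next∈bM = to (T.next∈++ (here end≡b))
    go : Tail E (b ∷ W) a → Tail E (a ∷ W) b → Span (pair a b)
    go Ta Tb with Tail.end∈W Ta | Tail.end∈W Tb
    ... | here end≡b | _          = direct a≢b Ta a∉W b∉W end≡b
    ... | there _    | here end≡a = resp (pair-sym b a) (direct (a≢b ∘ ≡.sym) Tb b∉W a∉W end≡a)
    ... | there endA∈W | there endB∈W = span-pair₄ a≢b a∉M b∉M 
        (good (a ∷ b ∷ []) conn-abM) (good (b ∷ []) conn-bM) (good (a ∷ []) conn-aM) (good [] conn-M)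
      where
      module Ta = Tail Ta
      module Tb = Tail Tb
      N = Tb.interior ++ W
      M = Ta.interior ++ N
      W⊆M : ∀ {x} → x ∈ˡ W → x ∈ˡ M
      W⊆M x∈W = ∈-++⁺ʳ Ta.interior (∈-++⁺ʳ Tb.interior x∈W)
      good : ∀ L → ConnectedIn E (L ++ M) → Good (L ++ M) []
      good L conn = record { disjoint = λ _ () ; connA = conn ; connB = connected-[] E ; covers = whole (∈-++⁺ʳ L ∘ W⊆M) }
      a∉M : a ∉ˡ M
      a∉M a∈M with ∈-++⁻ Ta.interior a∈M
      ... | inj₁ a∈A = Ta.b∉ a∈A
      ... | inj₂ a∈N with ∈-++⁻ Tb.interior a∈N
      ...   | inj₁ a∈B = Tb.avoids a∈B (here ≡.refl)
      ...   | inj₂ a∈W = a∉W a∈W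
      b∉M : b ∉ˡ M
      b∉M b∈M with ∈-++⁻ Ta.interior b∈M
      ... | inj₁ b∈A = Ta.avoids b∈A (here ≡.refl)
      ... | inj₂ b∈N with ∈-++⁻ Tb.interior b∈N
      ...   | inj₁ b∈B = Tb.b∉ b∈B
      ...   | inj₂ b∈W = b∉W b∈W
      conn-N : ConnectedIn E N
      conn-N = Tb.attach endB∈W (connected-nodes E p)
      endA∈N : Ta.end ∈ˡ N
      endA∈N = ∈-++⁺ʳ Tb.interior endA∈W
      conn-M : ConnectedIn E M
      conn-M = Ta.attach endA∈N conn-N
      conn-aM : ConnectedIn E (a ∷ M)
      conn-aM = Ta.attach-b∷ endA∈N conn-N
      conn-bM : ConnectedIn E (b ∷ M)
      conn-bM = connected-∷ E Tb.first (∈-++⁺ʳ Ta.interior (Tb.next∈++ endB∈W)) conn-M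
      conn-abM : ConnectedIn E (a ∷ b ∷ M)
      conn-abM = connected-∷ E Ta.first (there (Ta.next∈++ endA∈N)) conn-bM

  module Attached {b} (b∉W : b ∉ˡ W) (T : Tail E W b) where
    open Tail T renaming (end to j)
    M = interior
    b∉M++ : ∀ {A} → (∀ {x} → x ∈ˡ A → x ∈ˡ W) → b ∉ˡ M ++ A
    b∉M++ A⊆W b∈ with ∈-++⁻ M b∈
    ... | inj₁ b∈M = b∉ b∈M
    ... | inj₂ b∈A = b∉W (A⊆W b∈A)
    -- The tail enters `A` at `j`, so `M ++ A` is connected with or without `b`; its inner nodes are
    -- off the path and cannot meet `B`.
    extended : ∀ {A B} → Base A B → j ∈ˡ A → Span (between b (M ++ A))
    extended {A} {B} base j∈A = span-between (b∉M++ A⊆W)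
      (record { disjoint = λ { (here ≡.refl) x∈B → b∉W (B⊆W x∈B) ; (there x∈) → MA∩B x∈ }
              ; connA = attach-b∷ j∈A connA ; connB = connB ; covers = covers-⊇ (there ∘ ∈-++⁺ʳ M) id covers })
      (record { disjoint = MA∩B ; connA = attach j∈A connA ; connB = connB ; covers = covers-⊇ (∈-++⁺ʳ M) id covers })
      where
      open Base base
      MA∩B : Disjoint (M ++ A) B
      MA∩B x∈ x∈B with ∈-++⁻ M x∈
      ... | inj₁ x∈M = avoids x∈M (B⊆W x∈B)
      ... | inj₂ x∈A = disjoint x∈A x∈B
    others : ∀ {a} → a ∈ˡ W → a ≢ j → Span (pair b a)
    others {a} a∈W a≢j with base-pair a∈W end∈W a≢j
    ... | A , B , B′ , base , base′ , j∈A , a∉A =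
      span-pair a∉MA (resp (between-cong to from) (extended base′ (there j∈A))) (extended base j∈A)
      where
      a∉MA : a ∉ˡ M ++ A
      a∉MA a∈ with ∈-++⁻ M a∈
      ... | inj₁ a∈M = avoids a∈M a∈W
      ... | inj₂ a∈A = a∉A a∈A
      to : ∀ {x} → x ∈ˡ M ++ a ∷ A → x ∈ˡ a ∷ M ++ A
      to x∈ with ∈-++⁻ M x∈
      ... | inj₁ x∈M           = there (∈-++⁺ˡ x∈M)
      ... | inj₂ (here ≡.refl) = here ≡.refl
      ... | inj₂ (there x∈A)   = there (∈-++⁺ʳ M x∈A)
      from : ∀ {x} → x ∈ˡ a ∷ M ++ A → x ∈ˡ M ++ a ∷ A
      from (here ≡.refl) = ∈-++⁺ʳ M (here ≡.refl)
      from (there x∈) with ∈-++⁻ M x∈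
      ... | inj₁ x∈M = ∈-++⁺ˡ x∈M
      ... | inj₂ x∈A = ∈-++⁺ʳ M (there x∈A)

  -- The tail from b reaches W in a node j.  Every a ≠ j on the path is
  -- isolated by comparing two splits; j itself is what is then left over.
  span-boundary : ∀ {a b} → a ∈ˡ W → b ∉ˡ W → Span (pair b a)
  span-boundary {a} {b} a∈W b∉W with tail E (connected b v) v∈W b∉W
  ... | T with a ≟ Tail.end T
  ...   | no a≢j     = Attached.others b∉W T a∈W a≢j
  ...   | yes ≡.refl = span-pair j∉L (resp (between-cong to from) (extended base-whole end∈W))
                         (span-all L (Base.good base-whole) pairs)
    where
    open Attached b∉W T
    open Tail T renaming (end to j)
    -- As a set, `interior ++ W` is `L` with `j` added; the stars from `b` to these two sets differ
    -- by the wanted pair.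
    R = filter (λ x → ¬? (x ≟ j)) W
    L = interior ++ R
    j∉L : j ∉ˡ L
    j∉L j∈L with ∈-++⁻ interior j∈L
    ... | inj₁ j∈M = avoids j∈M end∈W
    ... | inj₂ j∈R = proj₂ (∈-filter⁻ (λ x → ¬? (x ≟ j)) {xs = W} j∈R) ≡.refl
    to : ∀ {x} → x ∈ˡ interior ++ W → x ∈ˡ j ∷ L
    to {x} x∈ with ∈-++⁻ interior x∈
    ... | inj₁ x∈M = there (∈-++⁺ˡ x∈M)
    ... | inj₂ x∈W with x ≟ j
    ...   | yes x≡j = here x≡j
    ...   | no x≢j  = there (∈-++⁺ʳ interior (∈-filter⁺ (λ x → ¬? (x ≟ j)) x∈W x≢j))
    from : ∀ {x} → x ∈ˡ j ∷ L → x ∈ˡ interior ++ W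
    from (here ≡.refl) = ∈-++⁺ʳ interior end∈W
    from (there x∈) with ∈-++⁻ interior x∈
    ... | inj₁ x∈M = ∈-++⁺ˡ x∈M
    ... | inj₂ x∈R = ∈-++⁺ʳ interior (proj₁ (∈-filter⁻ (λ x → ¬? (x ≟ j)) x∈R))
    pairs : ∀ {u} → u ∈ˡ L → Span (pair b u)
    pairs u∈L with ∈-++⁻ interior u∈L
    ... | inj₁ u∈M = span-outside b∉W (avoids u∈M) λ { ≡.refl → b∉ u∈M }
    ... | inj₂ u∈R with ∈-filter⁻ (λ x → ¬? (x ≟ j)) {xs = W} u∈R
    ...   | u∈W , u≢j = others u∈W u≢j

  span-edge : ∀ {g} → ¬ (src g ∈ˡ W × tgt g ∈ˡ W) → Span (unit g)
  span-edge {g} ¬both with src g ∈ˡ? W | tgt g ∈ˡ? W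
  ... | yes s∈W | yes t∈W = contradiction (s∈W , t∈W) ¬both
  ... | yes s∈W | no t∉W  = resp (pair-joins (joins-sym (joins-self g))) (span-boundary s∈W t∉W)
  ... | no s∉W  | yes t∈W = resp (pair-joins (joins-self g)) (span-boundary t∈W s∉W)
  ... | no s∉W  | no t∉W  = resp (pair-joins (joins-self g)) (span-outside s∉W t∉W (loopless g))

  -- Its point is the zero vector, which homogenises at `f` to `unit f`.
  everything : Good (allFin n) []
  everything = record
    { disjoint = λ _ ()
    ; connA    = λ {u} {u′} _ _ → Star.map (λ s → s , ∈-allFin _ , ∈-allFin _) (connected u u′)
    ; connB    = connected-[] E
    ; covers   = whole (λ {u} _ → ∈-allFin u) }

  Block : Set
  Block = Σ (List (Fin n)) λ A → Σ (List (Fin n)) λ B → Good A B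

  -- The homogenised point over ℤ: linear independence of these vectors in the field gives affine
  -- independence of the points.
  vec : Block → Fin m → ℤ
  vec (A , B , _) j = if does (f ≟ j) then + 1 else ptℤ A B j

  ι-vec : ∀ s j → ι (vec s j) ≈ homogenise f (pt (proj₁ s) (proj₁ (proj₂ s))) j
  ι-vec (A , B , _) j with does (f ≟ j) | does (together? A B (src j) (tgt j))
  ... | true  | _     = refl
  ... | false | true  = refl
  ... | false | false = refl

  -- The facet of a chordless cycle

  module _ (chordless : IsChordless G′ C) where

    ∈⇒node : ∀ {u} → u ∈ˡ W → _isNodeOf_ G′ u C
    ∈⇒node = go p (λ e∈ → ∈C⁺ (inj₁ e∈)) (f , ∈C⁺ (inj₂ ≡.refl) , v , joins-sym joins-f)
      where
      go : ∀ {v} (q : Walk G′ E v w) → (∀ {e} → e ∈ˡ edges G′ q → e ∈ C) → _isNodeOf_ G′ w C →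
           ∀ {u} → u ∈ˡ nodes G′ q → _isNodeOf_ G′ u C
      go ε                     q⊆C last (here ≡.refl) = last
      go ((e , _ , joins) ◅ q) q⊆C last (here ≡.refl) = e , q⊆C (here ≡.refl) , _ , joins
      go (s ◅ q)               q⊆C last (there u∈)    = go q (q⊆C ∘ there) last u∈

    inside-W⇒∈C : ∀ g → src g ∈ˡ W → tgt g ∈ˡ W → g ∈ C
    inside-W⇒∈C g s∈W t∈W with g ∈? C
    ... | yes g∈C = g∈C
    ... | no g∉C  = contradiction (∈⇒node s∈W , ∈⇒node t∈W) (chordless g (src g) (tgt g) g∉C (joins-self g))

    -- Any edge other than `e` and `f` between the two parts of the path would change as well, but
    -- it would be a chord.
    span-path-edge : ∀ {e} → e ∈ˡ edges G′ p → Span (λ g → unit e g ℤ.+ unit f g)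
    span-path-edge {e} e∈p with splitEdge p e∈p
    ... | a , b , p₁ , s@(_ , joins-e) , p₂ , eq =
      resp difference (gen (Base.good (base-split p₁ (e , s) p₂ eq)) ⊟ gen (Base.good base-whole))
      where
      A = nodes G′ p₁
      B = nodes G′ p₂
      open Base (base-split p₁ (e , s) p₂ eq)
      apart : ∀ {g u u′} → Joins g u u′ → u ∈ˡ A → u′ ∈ˡ B → ptℤ A B g ℤ.- ptℤ W [] g ≡ + 1
      apart joins u∈A u′∈B = ≡.cong₂ ℤ._-_
        (ptℤ≡1 joins λ { (inj₁ (_ , u′∈A)) → disjoint u′∈A u′∈B ; (inj₂ (u∈B , _)) → disjoint u∈A u∈B })
        (ptℤ≡0 {W} {[]} joins (inj₁ (A⊆W u∈A , B⊆W u′∈B)))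
      edges-p : edges G′ p ≡ edges G′ p₁ ++ e ∷ edges G′ p₂
      edges-p = ≡.trans (≡.cong (edges G′) eq) (edges-◅◅ p₁ _)
      unaffected : ∀ g → e ≢ g → f ≢ g → Dec (Together W [] (src g) (tgt g)) → ptℤ A B g ≡ ptℤ W [] g
      unaffected g e≢g f≢g (no ¬t) = ≡.trans (ptℤ≡1 (joins-self g) λ
        { (inj₁ (s∈A , t∈A)) → ¬t (inj₁ (A⊆W s∈A , A⊆W t∈A)) ; (inj₂ (s∈B , t∈B)) → ¬t (inj₁ (B⊆W s∈B , B⊆W t∈B)) })
        (≡.sym (ptℤ≡1 (joins-self g) ¬t))
      unaffected g e≢g f≢g (yes t@(inj₁ (s∈W , t∈W))) = ≡.trans (ptℤ≡0 (joins-self g) together) (≡.sym (ptℤ≡0 (joins-self g) t))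
        where
        together : Together A B (src g) (tgt g)
        together with ∈C⁻ (inside-W⇒∈C g s∈W t∈W)
        ... | inj₂ g≡f = contradiction (≡.sym g≡f) f≢g
        ... | inj₁ g∈p with ∈-++⁻ (edges G′ p₁) (≡.subst (g ∈ˡ_) edges-p g∈p)
        ...   | inj₁ g∈₁         = inj₁ (ends∈nodes p₁ g∈₁ (joins-self g))
        ...   | inj₂ (here g≡e)  = contradiction (≡.sym g≡e) e≢g
        ...   | inj₂ (there g∈₂) = inj₂ (ends∈nodes p₂ g∈₂ (joins-self g))
      difference : ∀ g → ptℤ A B g ℤ.- ptℤ W [] g ≡ unit e g ℤ.+ unit f g
      difference g with e ≟ g | f ≟ g
      ... | yes ≡.refl | yes ≡.refl = contradiction e∈p f∉p
      ... | yes ≡.refl | no _       = apart joins-e (last∈nodes p₁) (here ≡.refl)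
      ... | no _       | yes ≡.refl = apart joins-f (here ≡.refl) (last∈nodes p₂)
      ... | no e≢g     | no f≢g     = ≡.trans (≡.cong (ℤ._- ptℤ W [] g) (unaffected g e≢g f≢g (together? W [] (src g) (tgt g)))) (ℤ.+-inverseʳ (ptℤ W [] g))

    -- A functional that does not see unit f takes the same value on a point
    -- and on its homogenisation.
    vec-detects : Detects vec
    vec-detects φ lin i φᵢ≢0 with φ (unit f) ℤ.≟ + 0
    ... | no φf≢0 = (_ , _ , everything) , λ eq → φf≢0 (≡.trans (≡.sym (cong vec≡unit)) eq)
      where
      open Linear lin
      vec≡unit : ∀ j → vec (_ , _ , everything) j ≡ unit f j
      vec≡unit j with does (f ≟ j)
      ... | true  = ≡.refl
      ... | false = ptℤ≡0 {allFin n} {[]} (joins-self j) (inj₁ (∈-allFin _ , ∈-allFin _))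
    ... | yes φf≡0 = found
      where
      open Linear lin
      ignores-f : ∀ x k → φ (λ j → x j ℤ.+ k ℤ.* unit f j) ≡ φ x
      ignores-f x k = ≡.trans (add x (λ j → k ℤ.* unit f j))
        (≡.trans (≡.cong (ℤ._+_ (φ x)) (≡.trans (scale k (unit f)) (≡.trans (≡.cong (k ℤ.*_) φf≡0) (ℤ.*-zeroʳ k)))) (ℤ.+-identityʳ (φ x)))
      vec≡ : ∀ {A B} (good : Good A B) j → vec (A , B , good) j ≡ ptℤ A B j ℤ.+ (+ 1 ℤ.- ptℤ A B f) ℤ.* unit f j
      vec≡ {A} {B} good j with f ≟ j
      ... | yes ≡.refl = cancel (ptℤ A B f)
        where
        cancel : ∀ x → + 1 ≡ x ℤ.+ (+ 1 ℤ.- x) ℤ.* + 1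
        cancel = solve-∀
      ... | no _ = vanish (ptℤ A B j) (ptℤ A B f)
        where
        vanish : ∀ x y → x ≡ x ℤ.+ (+ 1 ℤ.- y) ℤ.* + 0
        vanish = solve-∀
      fromSpan : ∀ {x} → Span x → φ x ≢ + 0 → ∃[ s ] φ (vec s) ≢ + 0
      fromSpan sx φx≢0 with span-detect lin sx φx≢0
      ... | A , B , good , φ≢0 = (A , B , good) , λ eq → φ≢0
        (≡.trans (≡.sym (ignores-f (ptℤ A B) (+ 1 ℤ.- ptℤ A B f))) (≡.trans (≡.sym (cong (vec≡ good))) eq))
      found : ∃[ s ] φ (vec s) ≢ + 0
      -- Off the cycle `unit i` is in the span. On the path the sum of `unit i` and `unit f` is, and
      -- φ vanishes on `unit f`.
      found with i ∈? C
      ... | no i∉C = fromSpan (span-edge λ (s∈W , t∈W) → i∉C (inside-W⇒∈C i s∈W t∈W)) φᵢ≢0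
      ... | yes i∈C with ∈C⁻ i∈C
      ...   | inj₂ ≡.refl = contradiction φf≡0 φᵢ≢0
      ...   | inj₁ i∈p    = fromSpan (span-path-edge i∈p) λ eq → φᵢ≢0
        (≡.trans (≡.sym (≡.trans (add (unit i) (unit f)) (≡.trans (≡.cong (ℤ._+_ (φ (unit i))) φf≡0) (ℤ.+-identityʳ _)))) eq)

    private
      L = edges G′ p
      selection = select m vec vec-detects

      r : Vector (Vector Carrier m) m
      r i = pt (proj₁ (proj₁ selection i)) (proj₁ (proj₂ (proj₁ selection i)))

      r∈S : ∀ i → S-path f P (r i)
      r∈S i = good∈S (proj₂ (proj₂ (proj₁ selection i)))

      r-independent : AffinelyIndependent r
      r-independent = linear⇒affine f r λ coeff rel → proj₂ selection coeff λ j →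
        trans (sum-cong-≋ (λ i → *-congˡ (ι-vec (proj₁ selection i) j))) (rel j)

      gapf≉0 : ¬ (gap f L f ≈ 0#)
      gapf≉0 eq = 0≉1 (trans (sym eq) (trans (+-cong (δ-≡ f) (*-congˡ (indicator-∉ L f∉p)))
        (solve 0 (con (+ 1) :+ :- con (+ 1) :* con (+ 0) := con (+ 1)) refl)))
        where
        indicator-∉ : ∀ L {g} → g ∉ˡ L → indicator L g ≈ 0#
        indicator-∉ []      _       = refl
        indicator-∉ (e ∷ L) {g} g∉L = trans (+-cong (δ-≢ e g λ e≡g → g∉L (here (≡.sym e≡g))) (indicator-∉ L (g∉L ∘ there))) (+-identityˡ 0#)

      face : IsFace (Σ-path f P) Ξ
      -- `pt (allFin n) []`, the zero vector, is the substitute for points off the face.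
      face = conv-face {A = X} {B = S-path f P} (gap f L) (pt (allFin n) []) valid
        (λ x Xx → gap-dec (X.binary Xx) f L) (λ x Sx → proj₁ Sx , S⇒gap≈0 Sx) (λ x Xx eq → gap≈0⇒S Xx eq) (good∈S everything)
        where
        valid : ∀ x → X x → gap f L ∙ x ≤ 0#
        valid x Xx = ≤-respˡ-≈ (sym (trans (gap-∙ f L x) (+-comm _ _)))
          (≤-respʳ-≈ (-‿inverseˡ (sumL L x)) (+-monoʳ-≤ (- sumL L x) (Feasible.path-≤ Xx p uniq joins-f f∉p)))

      Points : ∀ {ℓ} → Pred (Vector Carrier m) ℓ → ℕ → Set _
      Points A k = Σ (Vector (Vector Carrier m) k) λ q → (∀ i → A (q i)) × AffinelyIndependent q

      -- Applied to `f`, this makes m positive, so that the dimension m - 1 of Σ is a natural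
      -- number.
      pred : ∀ {k} → Fin k → ∃[ d ] k ≡ suc d
      pred {suc d} _ = d , ≡.refl

    -- From below: m independent points of S and, off their hyperplane, `ones` as one more point of
    -- Ξ. From above: the hyperplane bounds Σ and the ambient space bounds Ξ.
    chordless⇒facet : IsFacet (Σ-path f P) Ξ
    chordless⇒facet with pred f
    ... | d , m≡1+d = face , d ,
      ( ≡.subst (λ k → Points Ξ (suc k)) m≡1+d (ones ∷ᵛ r
        , (λ { zero → conv-⊇ {A = X} ones∈X ; (suc i) → conv-⊇ {A = X} (proj₁ (r∈S i)) })
        , affine-extend (gap f L) ones r (λ i → S⇒gap≈0 (r∈S i)) (multi-edge p joins-f f∉p) r-independent)
      , λ k q _ indep → ≡.subst (λ l → k ℕ.≤ suc l) m≡1+d (affine⇒≤ q indep) ) ,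
      ( ≡.subst (Points (Σ-path f P)) m≡1+d (r , (λ i → conv-⊇ {A = S-path f P} (r∈S i)) , r-independent)
      , λ k q q∈Σ indep → ≡.subst (k ℕ.≤_) m≡1+d
          (hyperplane⇒≤ f (gap f L) q gapf≉0 (λ i → ∙-conv-≈0 (gap f L) (λ _ → S⇒gap≈0) (q∈Σ i)) indep) )

theorem10 : {c ℓ₁ ℓ₂ : Level} (K : OrderedField c ℓ₁ ℓ₂)
    {n m : ℕ} (G′ : Graph n m) (E : Subset m) → IsConnected G′ E →
    let open Polyhedral K
        open LiftedMulticut K G′ E
    in
    ((C : Subset m) → IsCycle G′ E C → (e : Fin m) → e ∈ C →
      IsFacet (Σ-cycle e C) Ξ ⇔ IsChordless G′ C)
    ×
    ((f : Fin m) (v w : Fin n) → f ∉ E → Graph.Joins G′ f v w →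
      (P : Subset m) → IsPath G′ E v w P →
      IsFacet (Σ-path f P) Ξ ⇔ IsChordless G′ (P ∪ ⁅ f ⁆))
theorem10 K G′ E connected = cycles , paths
  where
  open Polyhedral K
  open LiftedMulticut K G′ E

  -- Here `f` may be an edge of (V, E) or a lifted edge, so both parts are instances.
  facet⇔chordless : ∀ {f v w P} → Graph.Joins G′ f v w → f ∉ P → IsPath G′ E v w P →
                    IsFacet (Σ-path f P) Ξ ⇔ IsChordless G′ (P ∪ ⁅ f ⁆)
  facet⇔chordless {f} joins f∉P (p , uniq , isP) = mk⇔ facet⇒chordless chordless⇒facet
    where open PathFacet K G′ E connected p uniq joins (f∉P ∘ Equivalence.from (isP f)) isP

  cycles : ∀ C → IsCycle G′ E C → ∀ e → e ∈ C → IsFacet (Σ-cycle e C) Ξ ⇔ IsChordless G′ C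
  cycles C isC e e∈C with Walks.cycle⇒path G′ isC e∈C
  -- By definition `Σ-cycle e C` is `Σ-path e (C ∖ e)`; only the chordlessness side is rewritten,
  -- along (C ∖ e) ∪ {e} = C.
  ... | v , w , joins , isP = ≡.subst (λ D → IsFacet (Σ-cycle e C) Ξ ⇔ IsChordless G′ D) (Points.∖∪ K G′ E e∈C)
    (facet⇔chordless joins (x∉p∖x C e) isP)

  paths : ∀ f v w → f ∉ E → Graph.Joins G′ f v w → ∀ P → IsPath G′ E v w P →
          IsFacet (Σ-path f P) Ξ ⇔ IsChordless G′ (P ∪ ⁅ f ⁆)
  paths f v w f∉E joins P isP@(p , _ , isEdges) =
    facet⇔chordless joins (λ f∈P → f∉E (Walks.edges⊆ G′ p (Equivalence.to (isEdges f) f∈P))) isP
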